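{- There exists a function $g:\mathbb{N}\to\mathbb{R}$ with $g(k)/k \to 0$ as $k\to\infty$ such that for all integers $k,\ell \geq 2$ with $\ell \leq k/4$, \[ r(k,\ell) \leq 2^{ -\frac{2}{9}\ell + g(k)} \binom{k+\ell}{\ell}. \]
   Context: For integers $k,\ell\geq 2$, the off-diagonal Ramsey number $r(k,\ell)$ is the least integer $N$ such that every two-coloring of the edges of the complete graph $K_N$ with colors red and blue contains a red $K_k$ or a blue $K_\ell$. -}

module Defs where

open import Data.Nat as ℕ using (ℕ; _≤_; _<_; _*_; _^_; _+_)
open import Data.Nat.Combinatorics using (_C_)
open import Data.Integer as ℤ using (ℤ; +_; -[1+_])
open import Data.Rational as ℚ using (ℚ; ↥_; ↧ₙ_)
open import Data.Fin using (Fin)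
open import Data.Bool using (Bool; true; false)
open import Data.Product using (Σ; _×_; ∃)
open import Function.Definitions using (Injective)
open import Relation.Binary.PropositionalEquality using (_≡_)
open import Relation.Nullary using (¬_)

-- A red/blue edge colouring of K_N: a symmetric colour function on pairs
-- of vertices (true = red, false = blue; values on the diagonal are irrelevant).
record Colouring (N : ℕ) : Set where
  field
    colour : Fin N → Fin N → Bool
    symm   : ∀ i j → colour i j ≡ colour j i
open Colouring public

MonoClique : ∀ {N} → Colouring N → Bool → ℕ → Set
MonoClique {N} c b k =
  Σ (Fin k → Fin N) λ f → Injective _≡_ _≡_ f ×
    (∀ i j → ¬ (i ≡ j) → colour c (f i) (f j) ≡ b)

Arrows : ℕ → ℕ → ℕ → Set
Arrows N k ℓ = (c : Colouring N) → Data.Sum._⊎_ (MonoClique c true k) (MonoClique c false ℓ)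
  where import Data.Sum

IsRamseyNumber : ℕ → ℕ → ℕ → Set
IsRamseyNumber k ℓ r = Arrows r k ℓ × (∀ N → N < r → ¬ Arrows N k ℓ)

-- PowLe r x B  means  r ≤ 2^x · B  for natural r, B and rational x = p/q (q > 0),
-- expressed exactly as  r^q ≤ 2^p · B^q  (p ≥ 0)  or  r^q · 2^|p| ≤ B^q  (p < 0).
PowLe : ℕ → ℚ → ℕ → Set
PowLe r x B with ↥ x
... | + p      = r ^ (↧ₙ x) ≤ 2 ^ p * B ^ (↧ₙ x)
... | -[1+ p ] = r ^ (↧ₙ x) * 2 ^ (ℕ.suc p) ≤ B ^ (↧ₙ x)

SublinearFn : (ℕ → ℚ) → Set
SublinearFn g = ∀ (ε : ℚ) → ℚ.Positive ε →
  ∃ λ K → ∀ k → K ≤ k → ℚ._≤_ (ℚ.∣ g k ∣) (ℚ._*_ ε (+ k ℚ./ 1))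

{-# OPTIONS --safe #-}
module Submission where

-- Put p = 1 - a, and for vertex sets X, Y let the excess e(X, Y) be the number of red pairs minus
-- p|X||Y|. By Cauchy-Schwarz some v in X satisfies e(X, Z)² / |Z| ≥ p e(X, Y)² / |Y|, where Z is the
-- red neighbourhood of v in Y. Up to a negligible term e(X, Z) is the sum of the excesses of the
-- red and the blue neighbourhood of v in X with Z, so one of them is at least p e(X, Z) (extend the
-- red clique) or a e(X, Z) (extend the blue clique). Thus e² / |Y| falls by at most p³ in a red step and
-- pa² in a blue step, and Erdős-Szekeres inside Y finishes as soon as |Y| ≥ p^(-3i) (1 - p³)^(-ℓ),
-- where i is the number of red vertices still needed. Hence a graph on N vertices whose red density
-- slightly exceeds p is good once N³ ≥ poly(k) p^(-3k) (p a² (1 - p³))^(-ℓ).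
--
-- If the red density is smaller, some blue degree is about aN and one descends to ℓ - 1. This is
-- compatible with the bound poly(k) (6/7)^ℓ C(k+ℓ, ℓ) when a = 7ℓ / (6(k+ℓ)), and for this a the
-- requirement on N becomes ((6k - ℓ) / 6k)^(3k) (p + p² + p³)^ℓ ≥ 1, true for ℓ ≤ k/4. Finally
-- (6/7)^9 ≤ 1/4.

open import Defs
import Algebra.Definitions.RawSemiring as RawSemiring
import Algebra.Properties.CommutativeSemiring.Binomial as Binomial
open import Algebra.Bundles using (CommutativeSemiring)
open import Data.Bool using (Bool; true; false; if_then_else_)
import Data.Bool.Properties as Bool
open import Data.Fin using (Fin; zero; suc; toℕ)
import Data.Fin.Properties as Fin
import Data.Integer as ℤ
import Data.Integer.Properties as ℤ
import Data.Integer.Tactic.RingSolver as ℤ-Solver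
open import Data.List as List using (List; []; _∷_; length; filter; map)
import Data.List.Properties as List
open import Data.List.Membership.Propositional using (_∈_; find)
open import Data.List.Membership.Propositional.Properties using (∈-filter⁻)
open import Data.List.Relation.Unary.All as All using (All; []; _∷_)
open import Data.List.Relation.Unary.All.Properties using (¬Any⇒All¬)
open import Data.List.Relation.Unary.AllPairs using ([]; _∷_)
open import Data.List.Relation.Unary.Any using (here; there; any?)
open import Data.List.Relation.Unary.Unique.Propositional using (Unique)
import Data.List.Relation.Unary.Unique.Propositional.Properties as Unique
open import Data.Nat hiding (_/_)
open import Data.Nat.Combinatorics using (_C_; nCk+nC[k+1]≡[n+1]C[k+1])
open import Data.Nat.Combinatorics.Specification using (k>n⇒nCk≡0)
open import Data.Nat.ListAction using (sum)
open import Data.Nat.Properties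
open import Data.Nat.Tactic.RingSolver using (solve-∀)
open import Data.Product using (Σ; _×_; _,_; ∃; proj₁; proj₂)
open import Data.Rational as ℚ using (ℚ; mkℚ; ↥_; ↧ₙ_; toℚᵘ; _-_; _/_)
import Data.Rational.Properties as ℚ
open import Data.Rational.Unnormalised as ℚᵘ using (mkℚᵘ; *≡*; *≤*)
import Data.Rational.Unnormalised.Properties as ℚᵘ
open import Data.Sum as Sum using (_⊎_; inj₁; inj₂)
open import Data.Vec using (Vec; []; _∷_; lookup)
import Data.Vec.Relation.Unary.All as VecAll
open import Data.Vec.Relation.Unary.All.Properties using (lookup⁺)
open import Data.Vec.Relation.Unary.AllPairs as VecAllPairs using ([]; _∷_)
open import Relation.Binary.PropositionalEquality
open import Relation.Nullary using (¬_; Dec; yes; no; does; contradiction)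
open import Relation.Nullary.Decidable using (¬?; _×-dec_)
open import Relation.Unary using (Decidable)


-- Finite sums over lists and the Cauchy-Schwarz inequality.

private
  variable
    V V′ : Set

∑ : List V → (V → ℕ) → ℕ
∑ X f = sum (map f X)

∑-cong : ∀ (X : List V) {f g : V → ℕ} → (∀ v → f v ≡ g v) → ∑ X f ≡ ∑ X g
∑-cong []      f≗g = refl
∑-cong (x ∷ X) f≗g = cong₂ _+_ (f≗g x) (∑-cong X f≗g)

∑-mono : ∀ (X : List V) {f g : V → ℕ} → (∀ {v} → v ∈ X → f v ≤ g v) → ∑ X f ≤ ∑ X g
∑-mono []      f≤g = z≤n
∑-mono (x ∷ X) f≤g = +-mono-≤ (f≤g (here refl)) (∑-mono X (λ v∈X → f≤g (there v∈X)))

∑-+ : ∀ (X : List V) (f g : V → ℕ) → ∑ X (λ v → f v + g v) ≡ ∑ X f + ∑ X g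
∑-+ []      f g = refl
∑-+ (x ∷ X) f g = trans (cong (f x + g x +_) (∑-+ X f g)) (shuffle (f x) (g x) _ _)
  where
  shuffle : ∀ a b c d → (a + b) + (c + d) ≡ (a + c) + (b + d)
  shuffle = solve-∀

∑-*ˡ : ∀ (X : List V) c (f : V → ℕ) → ∑ X (λ v → c * f v) ≡ c * ∑ X f
∑-*ˡ []      c f = sym (*-zeroʳ c)
∑-*ˡ (x ∷ X) c f = trans (cong (c * f x +_) (∑-*ˡ X c f)) (sym (*-distribˡ-+ c (f x) (∑ X f)))

∑-const : ∀ (X : List V) c → ∑ X (λ _ → c) ≡ length X * c
∑-const []      c = refl
∑-const (x ∷ X) c = cong (c +_) (∑-const X c)

∑-swap : ∀ (X : List V) (Y : List V′) (f : V → V′ → ℕ) →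
         ∑ X (λ x → ∑ Y (f x)) ≡ ∑ Y (λ y → ∑ X (λ x → f x y))
∑-swap []      Y f = sym (trans (∑-const Y 0) (*-zeroʳ (length Y)))
∑-swap (x ∷ X) Y f = trans (cong (∑ Y (f x) +_) (∑-swap X Y f)) (sym (∑-+ Y (f x) _))

∑-≤⇒∃≤ : ∀ (X : List V) (f g : V → ℕ) → 0 < length X → ∑ X f ≤ ∑ X g →
         ∃ λ v → v ∈ X × f v ≤ g v
∑-≤⇒∃≤ (x ∷ X) f g _ Σf≤Σg with f x ≤? g x
... | yes fx≤gx = x , here refl , fx≤gx
... | no fx≰gx with X
...   | []     = contradiction (subst₂ _≤_ (+-identityʳ (f x)) (+-identityʳ (g x)) Σf≤Σg) fx≰gx
...   | z ∷ X′ with ∑-≤⇒∃≤ (z ∷ X′) f g z<s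
                    (≮⇒≥ λ Σg<Σf → <⇒≱ (+-mono-< (≰⇒> fx≰gx) Σg<Σf) Σf≤Σg)
...     | v , v∈X , fv≤gv = v , there v∈X , fv≤gv

-- Induction replaces the square of a - b, as subtraction truncates: passing from (a, b) to (a + 1,
-- b + 1) adds 2a + 2b + 2 to both sides.
2ab≤a²+b² : ∀ a b → 2 * (a * b) ≤ a * a + b * b
2ab≤a²+b² zero    b       = z≤n
2ab≤a²+b² (suc a) zero    = ≤-trans (≤-reflexive (cong (2 *_) (*-zeroʳ a))) z≤n
2ab≤a²+b² (suc a) (suc b) = begin
  2 * (suc a * suc b)                   ≡⟨ lhs a b ⟩
  2 * (a * b) + (2 * a + 2 * b + 2)     ≤⟨ +-monoˡ-≤ _ (2ab≤a²+b² a b) ⟩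
  a * a + b * b + (2 * a + 2 * b + 2)   ≡⟨ rhs a b ⟩
  suc a * suc a + suc b * suc b         ∎
  where
  open ≤-Reasoning
  lhs : ∀ a b → 2 * (suc a * suc b) ≡ 2 * (a * b) + (2 * a + 2 * b + 2)
  lhs = solve-∀
  rhs : ∀ a b → a * a + b * b + (2 * a + 2 * b + 2) ≡ suc a * suc a + suc b * suc b
  rhs = solve-∀

-- Induction on the list: the cross terms of the new entry with the old ones are bounded one by one
-- by `2ab≤a²+b²`.
∑-cauchySchwarz : ∀ (X : List V) (f : V → ℕ) →
                  ∑ X f * ∑ X f ≤ length X * ∑ X (λ v → f v * f v)
∑-cauchySchwarz []      f = z≤n
∑-cauchySchwarz (x ∷ X) f = begin
  (a + S) * (a + S)                     ≡⟨ square a S ⟩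
  a * a + (2 * (a * S) + S * S)         ≤⟨ +-monoʳ-≤ (a * a) (+-mono-≤ cross (∑-cauchySchwarz X f)) ⟩
  a * a + (n * (a * a) + Q + n * Q)     ≡⟨ collect n (a * a) Q ⟩
  suc n * (a * a + Q)                   ∎
  where
  open ≤-Reasoning
  a = f x
  S = ∑ X f
  n = length X
  Q = ∑ X (λ v → f v * f v)
  square : ∀ a S → (a + S) * (a + S) ≡ a * a + (2 * (a * S) + S * S)
  square = solve-∀
  collect : ∀ n b Q → b + (n * b + Q + n * Q) ≡ suc n * (b + Q)
  collect = solve-∀
  cross : 2 * (a * S) ≤ n * (a * a) + Q
  cross = begin
    2 * (a * S)                         ≡⟨ *-assoc 2 a S ⟨
    2 * a * S                           ≡⟨ ∑-*ˡ X (2 * a) f ⟨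
    ∑ X (λ v → 2 * a * f v)             ≤⟨ ∑-mono X (λ {v} _ → ≤-trans (≤-reflexive (*-assoc 2 a (f v))) (2ab≤a²+b² a (f v))) ⟩
    ∑ X (λ v → a * a + f v * f v)       ≡⟨ ∑-+ X _ _ ⟩
    ∑ X (λ _ → a * a) + Q               ≡⟨ cong (_+ Q) (∑-const X (a * a)) ⟩
    n * (a * a) + Q                     ∎

module _ {P : V → Set} (P? : Decidable P) where

  𝟙 : V → ℕ
  𝟙 v = if does (P? v) then 1 else 0

  ∑-filter : ∀ X (f : V → ℕ) → ∑ (filter P? X) f ≡ ∑ X (λ v → 𝟙 v * f v)
  ∑-filter []      f = refl
  ∑-filter (x ∷ X) f with does (P? x)
  ... | true  = cong₂ _+_ (sym (+-identityʳ (f x))) (∑-filter X f)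
  ... | false = ∑-filter X f

  length-filter-𝟙 : ∀ X → length (filter P? X) ≡ ∑ X 𝟙
  length-filter-𝟙 []      = refl
  length-filter-𝟙 (x ∷ X) with does (P? x)
  ... | true  = cong suc (length-filter-𝟙 X)
  ... | false = length-filter-𝟙 X

-- The graph of a colouring

module Graph {N : ℕ} (c : Colouring N) where

  -- Colours on the diagonal are arbitrary, so distinctness is part of adjacency; it is also what
  -- makes the vertices of a clique distinct.
  Adj : Bool → Fin N → Fin N → Set
  Adj b v w = v ≢ w × colour c v w ≡ b

  Adj? : ∀ b v w → Dec (Adj b v w)
  Adj? b v w = ¬? (v Fin.≟ w) ×-dec (colour c v w Bool.≟ b)

  Adj-sym : ∀ {b v w} → Adj b v w → Adj b w v
  Adj-sym {v = v} {w} (v≢w , cvw≡b) = (λ w≡v → v≢w (sym w≡v)) , trans (symm c w v) cvw≡b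

  nbhd : Bool → Fin N → List (Fin N) → List (Fin N)
  nbhd b v = filter (Adj? b v)

  nbhd-unique : ∀ b v {X} → Unique X → Unique (nbhd b v X)
  nbhd-unique b v = Unique.filter⁺ (Adj? b v)

  ∑-split-∉ : ∀ {v X} (f : Fin N → ℕ) → All (v ≢_) X →
              ∑ X f ≡ ∑ (nbhd true v X) f + ∑ (nbhd false v X) f
  ∑-split-∉         f []                  = refl
  ∑-split-∉ {v} {x ∷ X} f (v≢x ∷ v∉X) with v Fin.≟ x
  ... | yes v≡x = contradiction v≡x v≢x
  ... | no  _ with colour c v x
  ...   | true  = trans (cong (f x +_) (∑-split-∉ f v∉X)) (sym (+-assoc (f x) _ _))
  ...   | false = trans (cong (f x +_) (∑-split-∉ f v∉X)) (swap (f x) (∑ (nbhd true v X) f) (∑ (nbhd false v X) f))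
    where
    swap : ∀ a b d → a + (b + d) ≡ b + (a + d)
    swap = solve-∀

  -- In a list without repetitions `v` occurs once, and every other vertex is joined to it in
  -- exactly one colour.
  ∑-split : ∀ {v X} (f : Fin N → ℕ) → Unique X → v ∈ X →
            ∑ X f ≡ f v + (∑ (nbhd true v X) f + ∑ (nbhd false v X) f)
  ∑-split {v} f (x∉X ∷ _) (here refl) with v Fin.≟ v
  ... | yes _   = cong (f v +_) (∑-split-∉ f x∉X)
  ... | no  v≢v = contradiction refl v≢v
  ∑-split {v} {x ∷ X} f (x∉X ∷ X!) (there v∈X) with v Fin.≟ x
  ... | yes refl = contradiction refl (All.lookup x∉X v∈X)
  ... | no  _ with colour c v x
  ...   | true  = trans (cong (f x +_) (∑-split f X! v∈X)) (move (f x) (f v) (∑ (nbhd true v X) f) (∑ (nbhd false v X) f))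
    where
    move : ∀ a b d e → a + (b + (d + e)) ≡ b + ((a + d) + e)
    move = solve-∀
  ...   | false = trans (cong (f x +_) (∑-split f X! v∈X)) (move (f x) (f v) (∑ (nbhd true v X) f) (∑ (nbhd false v X) f))
    where
    move : ∀ a b d e → a + (b + (d + e)) ≡ b + (d + (a + e))
    move = solve-∀

  length≡∑1 : ∀ (X : List (Fin N)) → length X ≡ ∑ X (λ _ → 1)
  length≡∑1 X = sym (trans (∑-const X 1) (*-identityʳ (length X)))

  length-split : ∀ {v X} → Unique X → v ∈ X →
                 length X ≡ suc (length (nbhd true v X) + length (nbhd false v X))
  length-split {v} {X} X! v∈X
    rewrite length≡∑1 X | length≡∑1 (nbhd true v X) | length≡∑1 (nbhd false v X) = ∑-split (λ _ → 1) X! v∈X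

  -- The predicate `P` records where the vertices lie, which is what allows a clique found in a
  -- neighbourhood of `v` to be extended by `v`.
  Clique : Bool → ℕ → (Fin N → Set) → Set
  Clique b k P = Σ (Vec (Fin N) k) λ xs → VecAllPairs.AllPairs (Adj b) xs × VecAll.All P xs

  clique-empty : ∀ {b P} → Clique b 0 P
  clique-empty = [] , [] , VecAll.[]

  clique-mono : ∀ {b k P Q} → (∀ {w} → P w → Q w) → Clique b k P → Clique b k Q
  clique-mono P⊆Q (xs , adj , pxs) = xs , adj , VecAll.map P⊆Q pxs

  clique-cons : ∀ {b k P Q v} → P v → (∀ {w} → Q w → Adj b v w × P w) → Clique b k Q → Clique b (suc k) P
  clique-cons {v = v} pv Q⊆ (xs , adj , qxs) =
    v ∷ xs , VecAll.map (λ q → proj₁ (Q⊆ q)) qxs ∷ adj , pv VecAll.∷ VecAll.map (λ q → proj₂ (Q⊆ q)) qxs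

  clique-nbhd : ∀ {b k v X} → v ∈ X → Clique b k (_∈ nbhd b v X) → Clique b (suc k) (_∈ X)
  clique-nbhd {b} {v = v} v∈X = clique-cons v∈X λ w∈nb → let w∈X , a = ∈-filter⁻ (Adj? b v) w∈nb in a , w∈X

  lookup-adj : ∀ {b k} {xs : Vec (Fin N) k} → VecAllPairs.AllPairs (Adj b) xs →
               ∀ i j → i ≢ j → Adj b (lookup xs i) (lookup xs j)
  lookup-adj (ax ∷ axs) zero    zero    i≢j = contradiction refl i≢j
  lookup-adj (ax ∷ axs) zero    (suc j) i≢j = lookup⁺ ax j
  lookup-adj (ax ∷ axs) (suc i) zero    i≢j = Adj-sym (lookup⁺ ax i)
  lookup-adj (ax ∷ axs) (suc i) (suc j) i≢j = lookup-adj axs i j (λ i≡j → i≢j (cong suc i≡j))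

  clique⇒MonoClique : ∀ {b k P} → Clique b k P → MonoClique c b k
  clique⇒MonoClique (xs , adj , _) = lookup xs , injective , λ i j i≢j → proj₂ (lookup-adj adj i j i≢j)
    where
    injective : ∀ {i j} → lookup xs i ≡ lookup xs j → i ≡ j
    injective {i} {j} eq with i Fin.≟ j
    ... | yes i≡j = i≡j
    ... | no  i≢j = contradiction eq (proj₁ (lookup-adj adj i j i≢j))

  -- Weighted Erdős-Szekeres: with q = α/(α+β), more than q^(-i) (1-q)^(-j) - 1 vertices suffice. If
  -- neither neighbourhood of `v` is large enough, α times the red bound plus β times the blue bound
  -- contradicts the hypothesis; the successors on the two neighbourhood sizes absorb `v` and the
  -- successor on |X|.
  erdősSzekeres : ∀ α β i j X → Unique X → (α + β) ^ (i + j) < suc (length X) * (α ^ i * β ^ j) →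
                  Clique true i (_∈ X) ⊎ Clique false j (_∈ X)
  erdősSzekeres α β zero    j       X X! _ = inj₁ clique-empty
  erdősSzekeres α β (suc i) zero    X X! _ = inj₂ clique-empty
  erdősSzekeres α β (suc i) (suc j) [] X! h = contradiction h (≤⇒≯ (begin
    1 * (α ^ suc i * β ^ suc j)             ≡⟨ *-identityˡ _ ⟩
    α ^ suc i * β ^ suc j                   ≤⟨ *-mono-≤ (^-monoˡ-≤ (suc i) (m≤m+n α β)) (^-monoˡ-≤ (suc j) (m≤n+m β α)) ⟩
    (α + β) ^ suc i * (α + β) ^ suc j       ≡⟨ ^-distribˡ-+-* (α + β) (suc i) (suc j) ⟨
    (α + β) ^ (suc i + suc j)               ∎))
    where open ≤-Reasoning
  erdősSzekeres α β (suc i) (suc j) X@(v ∷ _) X! h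
    with (α + β) ^ (i + suc j) <? suc (length (nbhd true v X)) * (α ^ i * β ^ suc j)
  ... | yes red = Sum.map (clique-nbhd (here refl)) (clique-mono λ w∈nb → proj₁ (∈-filter⁻ (Adj? true v) w∈nb))
                    (erdősSzekeres α β i (suc j) _ (nbhd-unique true v X!) red)
  ... | no ¬red with (α + β) ^ (suc i + j) <? suc (length (nbhd false v X)) * (α ^ suc i * β ^ j)
  ...   | yes blue = Sum.map (clique-mono λ w∈nb → proj₁ (∈-filter⁻ (Adj? false v) w∈nb)) (clique-nbhd (here refl))
                       (erdősSzekeres α β (suc i) j _ (nbhd-unique false v X!) blue)
  ...   | no ¬blue = contradiction h (≤⇒≯ (begin
    suc (length X) * (α ^ suc i * β ^ suc j)      ≡⟨ cong (λ n → suc n * (α ^ suc i * β ^ suc j)) (length-split X! (here refl)) ⟩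
    (2 + (r + b)) * (α ^ suc i * β ^ suc j)       ≡⟨ rearrange r b α β (α ^ i) (β ^ j) ⟩
    α * (suc r * (α ^ i * β ^ suc j)) + β * (suc b * (α ^ suc i * β ^ j))
      ≤⟨ +-mono-≤ (*-monoʳ-≤ α (≮⇒≥ ¬red)) (*-monoʳ-≤ β (≮⇒≥ ¬blue)) ⟩
    α * (α + β) ^ (i + suc j) + β * (α + β) ^ (suc i + j)
      ≡⟨ cong (λ k → α * (α + β) ^ k + β * (α + β) ^ (suc i + j)) (+-suc i j) ⟩
    α * (α + β) ^ (suc i + j) + β * (α + β) ^ (suc i + j)
      ≡⟨ *-distribʳ-+ ((α + β) ^ (suc i + j)) α β ⟨
    (α + β) ^ (2 + (i + j))                       ≡⟨ cong (λ k → (α + β) ^ suc k) (+-suc i j) ⟨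
    (α + β) ^ (suc i + suc j)                     ∎))
    where
    open ≤-Reasoning
    r = length (nbhd true v X)
    b = length (nbhd false v X)
    rearrange : ∀ r b α β A B → (2 + (r + b)) * ((α * A) * (β * B)) ≡
                α * (suc r * (A * (β * B))) + β * (suc b * ((α * A) * B))
    rearrange = solve-∀

  -- Red pairs between two vertex sets.

  edges : List (Fin N) → List (Fin N) → ℕ
  edges X Y = ∑ X (λ v → length (nbhd true v Y))

  edges-[] : ∀ X → edges X [] ≡ 0
  edges-[] X = trans (∑-const X 0) (*-zeroʳ (length X))

  private
    a : Fin N → Fin N → ℕ
    a v = 𝟙 (Adj? true v)

  edges≡∑degree : ∀ X Y → edges X Y ≡ ∑ Y (λ y → ∑ X (λ v → a v y))
  edges≡∑degree X Y = trans (∑-cong X (λ v → length-filter-𝟙 (Adj? true v) Y)) (∑-swap X Y a)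

  -- Both sides count red walks from X through Y back to X, first by an endpoint, then by the middle
  -- vertex.
  ∑-edges-nbhd : ∀ X Y → ∑ X (λ v → edges X (nbhd true v Y)) ≡
                 ∑ Y (λ y → ∑ X (λ v → a v y) * ∑ X (λ v → a v y))
  ∑-edges-nbhd X Y = begin
    ∑ X (λ v → edges X (nbhd true v Y))
      ≡⟨ ∑-cong X (λ v → edges≡∑degree X (nbhd true v Y)) ⟩
    ∑ X (λ v → ∑ (nbhd true v Y) degree)
      ≡⟨ ∑-cong X (λ v → ∑-filter (Adj? true v) Y degree) ⟩
    ∑ X (λ v → ∑ Y (λ y → a v y * degree y))
      ≡⟨ ∑-swap X Y (λ v y → a v y * degree y) ⟩
    ∑ Y (λ y → ∑ X (λ v → a v y * degree y))
      ≡⟨ ∑-cong Y (λ y → trans (∑-cong X (λ v → *-comm (a v y) (degree y))) (∑-*ˡ X (degree y) (λ v → a v y))) ⟩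
    ∑ Y (λ y → degree y * degree y) ∎
    where
    open ≡-Reasoning
    degree : Fin N → ℕ
    degree y = ∑ X (λ v → a v y)

  edges² : ∀ X Y → edges X Y * edges X Y ≤ length Y * ∑ X (λ v → edges X (nbhd true v Y))
  edges² X Y rewrite ∑-edges-nbhd X Y | edges≡∑degree X Y = ∑-cauchySchwarz Y _

  -- The claim is linear in `w` and in the number of edges, so it can be averaged over `v`; `amgm`
  -- restores the quadratic form afterwards. With F = D E and s = P|X||Y|, the left sides add up to
  -- 2Fs + (F + s)e ≤ 2F(s + e) ≤ 2F², which Cauchy-Schwarz bounds by the sum of the right sides.
  good-vertex : ∀ P D e X Y → 0 < length X → P * length X * length Y + e ≤ D * edges X Y →
                ∃ λ v → v ∈ X × (let w = length (nbhd true v Y) in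
                  2 * length Y * D * (P * length X * w) + e * (D * w + P * length Y) ≤
                  2 * length Y * D * (D * edges X (nbhd true v Y)))
  good-vertex P D e X Y 0<n h with ∑-≤⇒∃≤ X f g 0<n ∑f≤∑g
    where
    n = length X
    y = length Y
    E = edges X Y
    Q = ∑ X (λ v → edges X (nbhd true v Y))
    s = P * n * y
    F = D * E
    c₁ = 2 * y * D * (P * n) + e * D
    c₂ = e * (P * y)
    c₃ = 2 * y * D * D
    f g : Fin N → ℕ
    f v = c₁ * length (nbhd true v Y) + c₂
    g v = c₃ * edges X (nbhd true v Y)
    open ≤-Reasoning
    lhs : ∀ y D P n e E → (2 * y * D * (P * n) + e * D) * E + n * (e * (P * y)) ≡
          2 * (D * E) * (P * n * y) + ((D * E) * e + (P * n * y) * e)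
    lhs = solve-∀
    rhs : ∀ F s e → 2 * F * s + (F * e + F * e) ≡ 2 * F * (s + e)
    rhs = solve-∀
    square : ∀ D E → 2 * (D * E) * (D * E) ≡ 2 * D * D * (E * E)
    square = solve-∀
    assemble : ∀ D y Q → 2 * D * D * (y * Q) ≡ 2 * y * D * D * Q
    assemble = solve-∀
    ∑f≤∑g : ∑ X f ≤ ∑ X g
    ∑f≤∑g = begin
      ∑ X f                                       ≡⟨ ∑-+ X _ _ ⟩
      ∑ X (λ v → c₁ * length (nbhd true v Y)) + ∑ X (λ _ → c₂)
                                                  ≡⟨ cong₂ _+_ (∑-*ˡ X c₁ _) (∑-const X c₂) ⟩
      c₁ * E + n * c₂                             ≡⟨ lhs y D P n e E ⟩
      2 * F * s + (F * e + s * e)                 ≤⟨ +-monoʳ-≤ (2 * F * s) (+-monoʳ-≤ (F * e) (*-monoˡ-≤ e (≤-trans (m≤m+n s e) h))) ⟩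
      2 * F * s + (F * e + F * e)                 ≡⟨ rhs F s e ⟩
      2 * F * (s + e)                             ≤⟨ *-monoʳ-≤ (2 * F) h ⟩
      2 * F * F                                   ≡⟨ square D E ⟩
      2 * D * D * (E * E)                         ≤⟨ *-monoʳ-≤ (2 * D * D) (edges² X Y) ⟩
      2 * D * D * (y * Q)                         ≡⟨ assemble D y Q ⟩
      c₃ * Q                                      ≡⟨ ∑-*ˡ X c₃ _ ⟨
      ∑ X g                                       ∎
  ... | v , v∈X , fv≤gv = v , v∈X , subst₂ _≤_ (fv≡ _ D P (length X) _ e) (gv≡ (length Y) D _) fv≤gv
    where
    fv≡ : ∀ y D P n w e → (2 * y * D * (P * n) + e * D) * w + e * (P * y) ≡
          2 * y * D * (P * n * w) + e * (D * w + P * y)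
    fv≡ = solve-∀
    gv≡ : ∀ y D E → 2 * y * D * D * E ≡ 2 * y * D * (D * E)
    gv≡ = solve-∀

-- One step of the descent

*-pos : ∀ {a b} → 0 < a → 0 < b → 0 < a * b
*-pos {b = b} 0<a 0<b = <-≤-trans 0<b (m≤n*m b _ {{>-nonZero 0<a}})

^-pos : ∀ {a} n → 0 < a → 0 < a ^ n
^-pos {a} n 0<a = m^n>0 a {{>-nonZero 0<a}} n

pos-*ʳ : ∀ a {b} → 0 < a * b → 0 < b
pos-*ʳ a {zero}  0<ab = subst (0 <_) (*-zeroʳ a) 0<ab
pos-*ʳ a {suc b} _    = z<s

cancelˡ : ∀ {a b c} → 0 < a → a * b ≤ a * c → b ≤ c
cancelˡ {a} 0<a = *-cancelˡ-≤ a {{>-nonZero 0<a}}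

square-mono : ∀ {a b} → a ≤ b → a * a ≤ b * b
square-mono a≤b = *-mono-≤ a≤b a≤b

square-cancel : ∀ {a b} → a * a ≤ b * b → a ≤ b
square-cancel a²≤b² = ≮⇒≥ λ b<a → <⇒≱ (*-mono-< b<a b<a) a²≤b²

-- Extracts an excess as a natural number: the hypothesis forces `s ≤ u`, so the truncated
-- difference is exact.
subtract : ∀ {c s t u} → 0 < c → c * s + t ≤ c * u → ∃ λ x → s + x ≡ u × t ≤ c * x
subtract {c} {s} {t} {u} 0<c h = u ∸ s , m+[n∸m]≡n s≤u , +-cancelˡ-≤ (c * s) t _ (begin
  c * s + t               ≤⟨ h ⟩
  c * u                   ≡⟨ cong (c *_) (m+[n∸m]≡n s≤u) ⟨
  c * (s + (u ∸ s))       ≡⟨ *-distribˡ-+ c s (u ∸ s) ⟩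
  c * s + c * (u ∸ s)     ∎)
  where
  open ≤-Reasoning
  s≤u : s ≤ u
  s≤u = cancelˡ 0<c (≤-trans (m≤m+n (c * s) t) h)

-- In this and the next two lemmas e, x, e′ stand for D times the excesses of (X, Y), (X, Z) and of the
-- chosen half of X with Z, and y, w for |Y|, |Z|. Here (Dw + Py)² ≥ 4 Dw Py is used.
amgm : ∀ y D P w e x → 0 < y → 0 < D → e * (D * w + P * y) ≤ 2 * y * D * x →
       e * e * w * P ≤ y * D * (x * x)
amgm y D P w e x 0<y 0<D h = cancelˡ (*-pos (*-pos (z<s {3}) 0<y) 0<D) (begin
  4 * y * D * (e * e * w * P)                         ≡⟨ four y D P w e ⟩
  e * e * (2 * (D * w * (P * y)) + 2 * (D * w * (P * y)))
    ≤⟨ *-monoʳ-≤ (e * e) (+-monoˡ-≤ _ (2ab≤a²+b² (D * w) (P * y))) ⟩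
  e * e * (D * w * (D * w) + P * y * (P * y) + 2 * (D * w * (P * y)))
                                                      ≡⟨ square (D * w) (P * y) e ⟩
  e * (D * w + P * y) * (e * (D * w + P * y))         ≤⟨ square-mono h ⟩
  2 * y * D * x * (2 * y * D * x)                     ≡⟨ last y D x ⟩
  4 * y * D * (y * D * (x * x))                       ∎)
  where
  open ≤-Reasoning
  four : ∀ y D P w e → 4 * y * D * (e * e * w * P) ≡ e * e * (2 * (D * w * (P * y)) + 2 * (D * w * (P * y)))
  four = solve-∀
  square : ∀ a b e → e * e * (a * a + b * b + 2 * (a * b)) ≡ e * (a + b) * (e * (a + b))
  square = solve-∀
  last : ∀ y D x → 2 * y * D * x * (2 * y * D * x) ≡ 4 * y * D * (y * D * (x * x))
  last = solve-∀

-- The two excesses F - Paw and G - Pbw add up to at least x - Aw, hence to at least (m/L)x since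
-- `L * A * w ≤ x`. As P/D + A/D = 1, one of them attains its share P/D or A/D of this.
dichotomy : ∀ P A m a b w x F G → 0 < P + A →
  let D = P + A ; L = suc m in
  P * suc (a + b) * w + x ≤ D * w + (F + G) → L * A * w ≤ x →
  (D * L * (P * a * w) + P * m * x ≤ D * L * F) ⊎ (D * L * (P * b * w) + A * m * x ≤ D * L * G)
dichotomy P A m a b w x F G 0<D h large
  with D * L * (P * a * w) + P * m * x ≤? D * L * F
     | D * L * (P * b * w) + A * m * x ≤? D * L * G
  where
  D = P + A
  L = suc m
... | yes p | _     = inj₁ p
... | no _  | yes q = inj₂ q
... | no ¬p | no ¬q = contradiction (begin-strict
  D * L * (P * suc (a + b) * w + x)                       ≤⟨ *-monoʳ-≤ (D * L) h ⟩
  D * L * (D * w + (F + G))                               ≡⟨ expand D L w F G ⟩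
  D * L * (D * w) + (D * L * F + D * L * G)               <⟨ +-monoʳ-< (D * L * (D * w)) (+-mono-< (≰⇒> ¬p) (≰⇒> ¬q)) ⟩
  D * L * (D * w) + ((D * L * (P * a * w) + P * m * x) + (D * L * (P * b * w) + A * m * x))
                                                          ≡⟨ regroup P A m a b w x ⟩
  D * (L * (P * suc (a + b) * w) + m * x + L * A * w)     ≤⟨ *-monoʳ-≤ D (+-monoʳ-≤ _ large) ⟩
  D * (L * (P * suc (a + b) * w) + m * x + x)             ≡⟨ final P A m a b w x ⟩
  D * L * (P * suc (a + b) * w + x)                       ∎) (<-irrefl refl)
  where
  open ≤-Reasoning
  D = P + A
  L = suc m
  expand : ∀ D L w F G → D * L * (D * w + (F + G)) ≡ D * L * (D * w) + (D * L * F + D * L * G)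
  expand = solve-∀
  regroup : ∀ P A m a b w x →
    (P + A) * suc m * ((P + A) * w) + (((P + A) * suc m * (P * a * w) + P * m * x) + ((P + A) * suc m * (P * b * w) + A * m * x)) ≡
    (P + A) * (suc m * (P * suc (a + b) * w) + m * x + suc m * A * w)
  regroup = solve-∀
  final : ∀ P A m a b w x →
    (P + A) * (suc m * (P * suc (a + b) * w) + m * x + x) ≡ (P + A) * suc m * (P * suc (a + b) * w + x)
  final = solve-∀

-- One step of the invariant of `book`, with q = P for red and q = A for blue. Combining e′ ≥
-- qmx/(DL) with x² ≥ e²wP/(yD) costs the factor q²Pm²/(D³L²), which is ρ/δ or σ/δ.
propagate : ∀ P D L q m y w e x e′ K Z τ → 0 < y → 0 < D → 0 < L →
  q * m * x ≤ D * L * e′ → e * e * w * P ≤ y * D * (x * x) →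
  y * (K * (D * D * D * (L * L) * Z)) ≤ e * e * (q * q * P * (m * m) * τ) →
  w * (K * Z) ≤ e′ * e′ * τ
propagate P D L q m y w e x e′ K Z τ 0<y 0<D 0<L h₁ h₂ h₃ =
  cancelˡ (*-pos 0<y (*-pos (*-pos (*-pos 0<D 0<D) 0<D) (*-pos 0<L 0<L))) (begin
  y * (D * D * D * (L * L)) * (w * (K * Z))        ≡⟨ e₁ y D L w K Z ⟩
  w * (y * (K * (D * D * D * (L * L) * Z)))        ≤⟨ *-monoʳ-≤ w h₃ ⟩
  w * (e * e * (q * q * P * (m * m) * τ))          ≡⟨ e₂ w e q P m τ ⟩
  q * q * (m * m) * τ * (e * e * w * P)            ≤⟨ *-monoʳ-≤ (q * q * (m * m) * τ) h₂ ⟩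
  q * q * (m * m) * τ * (y * D * (x * x))          ≡⟨ e₃ q m τ y D x ⟩
  y * D * τ * (q * m * x * (q * m * x))            ≤⟨ *-monoʳ-≤ (y * D * τ) (square-mono h₁) ⟩
  y * D * τ * (D * L * e′ * (D * L * e′))          ≡⟨ e₄ y D τ L e′ ⟩
  y * (D * D * D * (L * L)) * (e′ * e′ * τ)        ∎)
  where
  open ≤-Reasoning
  e₁ : ∀ y D L w K Z → y * (D * D * D * (L * L)) * (w * (K * Z)) ≡ w * (y * (K * (D * D * D * (L * L) * Z)))
  e₁ = solve-∀
  e₂ : ∀ w e q P m τ → w * (e * e * (q * q * P * (m * m) * τ)) ≡ q * q * (m * m) * τ * (e * e * w * P)
  e₂ = solve-∀
  e₃ : ∀ q m τ y D x → q * q * (m * m) * τ * (y * D * (x * x)) ≡ y * D * τ * (q * m * x * (q * m * x))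
  e₃ = solve-∀
  e₄ : ∀ y D τ L e → y * D * τ * (D * L * e * (D * L * e)) ≡ y * (D * D * D * (L * L)) * (e * e * τ)
  e₄ = solve-∀

*-^ : ∀ a b n → (a * b) ^ n ≡ a ^ n * b ^ n
*-^ a b zero    = refl
*-^ a b (suc n) = trans (cong (a * b *_) (*-^ a b n)) (interchange a b (a ^ n) (b ^ n))
  where
  interchange : ∀ a b x y → a * b * (x * y) ≡ a * x * (b * y)
  interchange = solve-∀

-- p = P/D and a = A/D; ρ/δ = p³(m/L)² and σ/δ = pa²(m/L)² are the factors lost by e²/|Y| in a red and
-- a blue step, where m/L = 1 - 1/L pays for the vertex v itself.
module Parameters (P A m : ℕ) where

  -- `α` and `β` are p³ and 1 - p³ scaled by D³, the weights used in Erdős-Szekeres; `β` is D³ - P³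
  -- in factored form, free of subtraction.
  D L α β ρ σ δ : ℕ
  D = P + A
  L = suc m
  α = P * P * P
  β = A * (D * D + D * P + P * P)
  ρ = P * P * P * (m * m)
  σ = A * A * P * (m * m)
  δ = D * D * D * (L * L)

  α+β≡D³ : α + β ≡ D * D * D
  α+β≡D³ = cube P A
    where
    cube : ∀ P A → P * P * P + A * ((P + A) * (P + A) + (P + A) * P + P * P) ≡ (P + A) * (P + A) * (P + A)
    cube = solve-∀

  σ≤δ : σ ≤ δ
  σ≤δ = *-mono-≤ (*-mono-≤ (*-mono-≤ (m≤n+m A P) (m≤n+m A P)) (m≤m+n P A)) (square-mono (n≤1+n m))

  -- The factor 4L²A² is the square of the 2LA that `excess-large` has to produce, and (α+β)^ℓ comes
  -- from the Erdős-Szekeres threshold.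
  K : ℕ → ℕ
  K ℓ = 4 * (L * L) * (A * A) * (α + β) ^ ℓ

  -- While `Y` is too small for Erdős-Szekeres, the invariant keeps e so large that the pairs lost
  -- with the chosen vertex fit into the fraction 1/L allowed by `dichotomy`. The factors m² and σ
  -- are bounded by L² and δ.
  excess-large : ∀ i j ℓ y e → 0 < P → 0 < A → 0 < m →
    y * (α ^ i * β ^ ℓ) ≤ (α + β) ^ (i + ℓ) →
    y * (K ℓ * δ ^ (i + j)) ≤ e * e * (ρ ^ i * σ ^ j * β ^ ℓ) →
    2 * L * A * y ≤ e
  excess-large i j ℓ y e 0<P 0<A 0<m few h = square-cancel (cancelˡ 0<τ (begin
    τ * (2 * L * A * y * (2 * L * A * y))           ≡⟨ cong (λ t → t * σ ^ j * β ^ ℓ * (2 * L * A * y * (2 * L * A * y))) (*-^ α (m * m) i) ⟩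
    α ^ i * M ^ i * σ ^ j * β ^ ℓ * (2 * L * A * y * (2 * L * A * y))
                                                    ≡⟨ e₁ (α ^ i) (M ^ i) (σ ^ j) (β ^ ℓ) L A y ⟩
    4 * (L * L) * (A * A) * y * (y * (α ^ i * β ^ ℓ)) * (M ^ i * σ ^ j)
      ≤⟨ *-mono-≤ (*-monoʳ-≤ (4 * (L * L) * (A * A) * y) few) (*-mono-≤ (^-monoˡ-≤ i (square-mono (n≤1+n m))) (^-monoˡ-≤ j σ≤δ)) ⟩
    4 * (L * L) * (A * A) * y * (α + β) ^ (i + ℓ) * ((L * L) ^ i * δ ^ j)
      ≡⟨ cong (λ t → 4 * (L * L) * (A * A) * y * t * ((L * L) ^ i * δ ^ j)) (^-distribˡ-+-* (α + β) i ℓ) ⟩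
    4 * (L * L) * (A * A) * y * ((α + β) ^ i * (α + β) ^ ℓ) * ((L * L) ^ i * δ ^ j)
      ≡⟨ cong (λ t → 4 * (L * L) * (A * A) * y * (t ^ i * (α + β) ^ ℓ) * ((L * L) ^ i * δ ^ j)) α+β≡D³ ⟩
    4 * (L * L) * (A * A) * y * ((D * D * D) ^ i * (α + β) ^ ℓ) * ((L * L) ^ i * δ ^ j)
      ≡⟨ e₂ (4 * (L * L) * (A * A)) y ((D * D * D) ^ i) ((α + β) ^ ℓ) ((L * L) ^ i) (δ ^ j) ⟩
    y * (K ℓ * ((D * D * D) ^ i * (L * L) ^ i * δ ^ j))
      ≡⟨ cong (λ t → y * (K ℓ * (t * δ ^ j))) (*-^ (D * D * D) (L * L) i) ⟨
    y * (K ℓ * (δ ^ i * δ ^ j))                     ≡⟨ cong (λ t → y * (K ℓ * t)) (^-distribˡ-+-* δ i j) ⟨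
    y * (K ℓ * δ ^ (i + j))                         ≤⟨ h ⟩
    e * e * τ                                       ≡⟨ *-comm (e * e) τ ⟩
    τ * (e * e)                                     ∎))
    where
    open ≤-Reasoning
    M = m * m
    τ = ρ ^ i * σ ^ j * β ^ ℓ
    0<M : 0 < M
    0<M = *-pos 0<m 0<m
    0<β : 0 < β
    0<β = *-pos 0<A (<-≤-trans (*-pos 0<P 0<P) (m≤n+m _ _))
    0<τ : 0 < τ
    0<τ = *-pos (*-pos (^-pos i (*-pos (*-pos (*-pos 0<P 0<P) 0<P) 0<M)) (^-pos j (*-pos (*-pos (*-pos 0<A 0<A) 0<P) 0<M)))
                (^-pos ℓ 0<β)
    e₁ : ∀ a b s t L A y → a * b * s * t * (2 * L * A * y * (2 * L * A * y)) ≡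
         4 * (L * L) * (A * A) * y * (y * (a * t)) * (b * s)
    e₁ = solve-∀
    e₂ : ∀ k y a b l d → k * y * (a * b) * (l * d) ≡ y * (k * b * (a * l * d))
    e₂ = solve-∀

-- The book argument on a pair of sets.

module Book {N : ℕ} (c : Colouring N) (P A m ℓ : ℕ) (0<P : 0 < P) (0<A : 0 < A) (0<m : 0 < m) where

  open Graph c
  open Parameters P A m

  private
    0<D : 0 < D
    0<D = <-≤-trans 0<P (m≤m+n P A)

  -- Each chosen vertex is red to all that remains of `Y`, so a red clique inside `Y` extends the
  -- red vertices chosen; hence red cliques may use both sets, while blue ones stay in one. The last
  -- hypothesis is the invariant: e²/|Y| still pays for i red and j blue steps.
  book : ∀ i j X Y e → Unique X → Unique Y → 0 < e →
    P * length X * length Y + e ≤ D * edges X Y →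
    length Y * (K ℓ * δ ^ (i + j)) ≤ e * e * (ρ ^ i * σ ^ j * β ^ ℓ) →
    Clique true i (λ w → w ∈ X ⊎ w ∈ Y) ⊎ Clique false j (_∈ X) ⊎ Clique false ℓ (_∈ Y)
  book zero    j       X Y e X! Y! 0<e dense big = inj₁ clique-empty
  book (suc i) zero    X Y e X! Y! 0<e dense big = inj₂ (inj₁ clique-empty)
  book (suc i) (suc j) []      Y       e X! Y! 0<e dense big =
    contradiction (<-≤-trans 0<e (≤-trans (m≤n+m e _) (≤-trans dense (≤-reflexive (*-zeroʳ D))))) λ ()
  book (suc i) (suc j) X@(_ ∷ _) []      e X! Y! 0<e dense big =
    contradiction (<-≤-trans 0<e (≤-trans (m≤n+m e _) (≤-trans dense (≤-reflexive (trans (cong (D *_) (edges-[] X)) (*-zeroʳ D)))))) λ ()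
  book (suc i) (suc j) X@(_ ∷ _) Y@(_ ∷ _) e X! Y! 0<e dense big
    -- Either Erdős-Szekeres inside `Y` finishes, or the failed inequality is the upper bound on |Y|
    -- that `excess-large` asks for.
    with (α + β) ^ (suc i + ℓ) <? suc (length Y) * (α ^ suc i * β ^ ℓ)
  ... | yes many = Sum.map (clique-mono inj₂) inj₂ (erdősSzekeres α β (suc i) ℓ Y Y! many)
  ... | no ¬many = step (good-vertex P D e X Y z<s dense)
    where
    open ≤-Reasoning
    y = length Y

    2LAy≤e : 2 * L * A * y ≤ e
    2LAy≤e = excess-large (suc i) (suc j) ℓ y e 0<P 0<A 0<m
               (≤-trans (*-monoˡ-≤ _ (n≤1+n y)) (≮⇒≥ ¬many)) big

    0<2yD : 0 < 2 * y * D
    0<2yD = *-pos (*-pos {2} {y} z<s z<s) 0<D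

    step : (∃ λ v → v ∈ X × (let w = length (nbhd true v Y) in
             2 * y * D * (P * length X * w) + e * (D * w + P * y) ≤ 2 * y * D * (D * edges X (nbhd true v Y)))) →
           Clique true (suc i) (λ w → w ∈ X ⊎ w ∈ Y) ⊎ Clique false (suc j) (_∈ X) ⊎ Clique false ℓ (_∈ Y)
    step (v , v∈X , good) with subtract 0<2yD good
    ... | x , excess-v , x-large = branch (dichotomy P A m a b w x F G 0<D split x≥LAw)
      where
      Z = nbhd true v Y
      w = length Z
      X₁ = nbhd true v X
      X₂ = nbhd false v X
      a = length X₁
      b = length X₂
      F = D * edges X₁ Z
      G = D * edges X₂ Z

      0<x : 0 < x
      0<x = pos-*ʳ (2 * y * D) (<-≤-trans (*-pos 0<e (<-≤-trans (*-pos 0<P z<s) (m≤n+m (P * y) (D * w)))) x-large)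

      sharp : e * e * w * P ≤ y * D * (x * x)
      sharp = amgm y D P w e x z<s 0<D x-large

      split : P * suc (a + b) * w + x ≤ D * w + (F + G)
      split = begin
        P * suc (a + b) * w + x         ≡⟨ cong (λ n → P * n * w + x) (length-split X! v∈X) ⟨
        P * length X * w + x            ≡⟨ excess-v ⟩
        D * edges X Z                   ≡⟨ cong (D *_) (∑-split (λ u → length (nbhd true u Z)) X! v∈X) ⟩
        D * (length (nbhd true v Z) + (edges X₁ Z + edges X₂ Z))
                                        -- The pairs of `v` itself are bounded trivially by `w`;
                                        -- `x≥LAw` makes this affordable.
                                        ≤⟨ *-monoʳ-≤ D (+-monoˡ-≤ _ (List.length-filter (Adj? true v) Z)) ⟩
        D * (w + (edges X₁ Z + edges X₂ Z))
                                        ≡⟨ distribute D w (edges X₁ Z) (edges X₂ Z) ⟩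
        D * w + (F + G)                 ∎
        where
        distribute : ∀ D w f g → D * (w + (f + g)) ≡ D * w + (D * f + D * g)
        distribute = solve-∀

      x≥LAw : L * A * w ≤ x
      x≥LAw = cancelˡ 0<2yD (begin
        2 * y * D * (L * A * w)         ≡⟨ rearrange y D L A w ⟩
        2 * L * A * y * (D * w)         ≤⟨ *-monoˡ-≤ (D * w) 2LAy≤e ⟩
        e * (D * w)                     ≤⟨ *-monoʳ-≤ e (m≤m+n (D * w) (P * y)) ⟩
        e * (D * w + P * y)             ≤⟨ x-large ⟩
        2 * y * D * x                   ∎)
        where
        rearrange : ∀ y D L A w → 2 * y * D * (L * A * w) ≡ 2 * L * A * y * (D * w)
        rearrange = solve-∀

      0<DL : 0 < D * L
      0<DL = *-pos 0<D z<s

      branch : (D * L * (P * a * w) + P * m * x ≤ D * L * F) ⊎ (D * L * (P * b * w) + A * m * x ≤ D * L * G) →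
               Clique true (suc i) (λ w → w ∈ X ⊎ w ∈ Y) ⊎ Clique false (suc j) (_∈ X) ⊎ Clique false ℓ (_∈ Y)
      branch (inj₁ red) with subtract 0<DL red
      ... | e′ , excess′ , e′-large = Sum.map redder (Sum.map (clique-mono X₁⊆X) (clique-mono Z⊆Y))
            (book i (suc j) X₁ Z e′ (nbhd-unique true v X!) (nbhd-unique true v Y!)
              (pos-*ʳ (D * L) (<-≤-trans (*-pos (*-pos 0<P 0<m) 0<x) e′-large))
              (≤-reflexive excess′)
              (propagate P D L P m y w e x e′ (K ℓ) (δ ^ (i + suc j)) (ρ ^ i * σ ^ suc j * β ^ ℓ)
                z<s 0<D z<s e′-large sharp
                (≤-trans big (≤-reflexive (cong (e * e *_) (assoc ρ (ρ ^ i) (σ ^ suc j) (β ^ ℓ)))))))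
        where
        assoc : ∀ r s t u → r * s * t * u ≡ r * (s * t * u)
        assoc = solve-∀
        X₁⊆X : ∀ {u} → u ∈ X₁ → u ∈ X
        X₁⊆X u∈X₁ = proj₁ (∈-filter⁻ (Adj? true v) u∈X₁)
        Z⊆Y : ∀ {u} → u ∈ Z → u ∈ Y
        Z⊆Y u∈Z = proj₁ (∈-filter⁻ (Adj? true v) u∈Z)
        redder : Clique true i (λ u → u ∈ X₁ ⊎ u ∈ Z) → Clique true (suc i) (λ u → u ∈ X ⊎ u ∈ Y)
        redder = clique-cons (inj₁ v∈X) λ where
          (inj₁ u∈X₁) → proj₂ (∈-filter⁻ (Adj? true v) {xs = X} u∈X₁) , inj₁ (X₁⊆X u∈X₁)
          (inj₂ u∈Z)  → proj₂ (∈-filter⁻ (Adj? true v) {xs = Y} u∈Z) , inj₂ (Z⊆Y u∈Z)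
      branch (inj₂ blue) with subtract 0<DL blue
      ... | e′ , excess′ , e′-large = Sum.map (clique-mono (Sum.map X₂⊆X Z⊆Y)) (Sum.map (clique-nbhd v∈X) (clique-mono Z⊆Y))
            (book (suc i) j X₂ Z e′ (nbhd-unique false v X!) (nbhd-unique true v Y!)
              (pos-*ʳ (D * L) (<-≤-trans (*-pos (*-pos 0<A 0<m) 0<x) e′-large))
              (≤-reflexive excess′)
              (propagate P D L A m y w e x e′ (K ℓ) (δ ^ (suc i + j)) (ρ ^ suc i * σ ^ j * β ^ ℓ)
                z<s 0<D z<s e′-large sharp
                (≤-trans (≤-reflexive (cong (λ n → y * (K ℓ * δ ^ n)) (sym (+-suc (suc i) j))))
                  (≤-trans big (≤-reflexive (cong (e * e *_) (assoc σ (ρ ^ suc i) (σ ^ j) (β ^ ℓ))))))))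
        where
        assoc : ∀ s r t u → r * (s * t) * u ≡ s * (r * t * u)
        assoc = solve-∀
        X₂⊆X : ∀ {u} → u ∈ X₂ → u ∈ X
        X₂⊆X u∈X₂ = proj₁ (∈-filter⁻ (Adj? false v) u∈X₂)
        Z⊆Y : ∀ {u} → u ∈ Z → u ∈ Y
        Z⊆Y u∈Z = proj₁ (∈-filter⁻ (Adj? true v) u∈Z)

-- Bernoulli estimates

-- Bernoulli's inequality (1 − 1/(m+1))^h ≥ 1 − h/(m+1), where d = m + 1 − h.
bernoulli-lower : ∀ m h d → h + d ≡ suc m → suc m ^ h * d ≤ m ^ h * suc m
bernoulli-lower m zero    d eq = ≤-reflexive (cong (1 *_) eq)
bernoulli-lower m (suc h) d eq = begin
  suc m * suc m ^ h * d         ≡⟨ e₁ (suc m) (suc m ^ h) d ⟩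
  suc m ^ h * (suc m * d)       ≤⟨ *-monoʳ-≤ (suc m ^ h) (+-monoˡ-≤ (m * d) (m+n≤o⇒n≤o h (≤-reflexive (suc-injective eq)))) ⟩
  suc m ^ h * (m + m * d)       ≡⟨ e₂ (suc m ^ h) m d ⟩
  m * (suc m ^ h * suc d)       ≤⟨ *-monoʳ-≤ m (bernoulli-lower m h (suc d) (trans (+-suc h d) eq)) ⟩
  m * (m ^ h * suc m)           ≡⟨ *-assoc m (m ^ h) (suc m) ⟨
  m * m ^ h * suc m             ∎
  where
  open ≤-Reasoning
  e₁ : ∀ s t d → s * t * d ≡ t * (s * d)
  e₁ = solve-∀
  e₂ : ∀ t m d → t * (m + m * d) ≡ m * (t * suc d)
  e₂ = solve-∀

-- The factor d/(m+1) left by `bernoulli-lower` is at least 1/2.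
bernoulli-double : ∀ m h → 2 * h ≤ suc m → suc m ^ h ≤ 2 * m ^ h
bernoulli-double m h 2h≤1+m = *-cancelʳ-≤ _ _ (suc m) (begin
  suc m ^ h * suc m             ≤⟨ *-monoʳ-≤ (suc m ^ h) 1+m≤2d ⟩
  suc m ^ h * (2 * d)           ≡⟨ e₁ (suc m ^ h) d ⟩
  2 * (suc m ^ h * d)           ≤⟨ *-monoʳ-≤ 2 (bernoulli-lower m h d h+d≡1+m) ⟩
  2 * (m ^ h * suc m)           ≡⟨ *-assoc 2 (m ^ h) (suc m) ⟨
  2 * m ^ h * suc m             ∎)
  where
  open ≤-Reasoning
  d = suc m ∸ h
  h+d≡1+m : h + d ≡ suc m
  h+d≡1+m = m+[n∸m]≡n (≤-trans (m≤m+n h _) 2h≤1+m)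
  1+m≤2d : suc m ≤ 2 * d
  1+m≤2d = +-cancelˡ-≤ (2 * h) _ _ (begin
    2 * h + suc m       ≤⟨ +-monoˡ-≤ (suc m) 2h≤1+m ⟩
    suc m + suc m       ≡⟨ cong (λ n → n + n) h+d≡1+m ⟨
    (h + d) + (h + d)   ≡⟨ e₂ h d ⟩
    2 * h + 2 * d       ∎)
    where
    e₂ : ∀ h d → (h + d) + (h + d) ≡ 2 * h + 2 * d
    e₂ = solve-∀
  e₁ : ∀ t d → t * (2 * d) ≡ 2 * (t * d)
  e₁ = solve-∀

-- Bernoulli's inequality 1 + j/P ≤ (1 + 1/P)^j.
bernoulli-upper : ∀ P j → (P + j) * P ^ j ≤ P * suc P ^ j
bernoulli-upper P zero    = ≤-reflexive (cong (_* 1) (+-identityʳ P))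
bernoulli-upper P (suc j) = begin
  (P + suc j) * (P * P ^ j)             ≤⟨ m≤m+n _ (j * P ^ j) ⟩
  (P + suc j) * (P * P ^ j) + j * P ^ j ≡⟨ e₁ P j (P ^ j) ⟩
  suc P * ((P + j) * P ^ j)             ≤⟨ *-monoʳ-≤ (suc P) (bernoulli-upper P j) ⟩
  suc P * (P * suc P ^ j)               ≡⟨ e₂ P (suc P ^ j) ⟩
  P * (suc P * suc P ^ j)               ∎
  where
  open ≤-Reasoning
  e₁ : ∀ P j x → (P + suc j) * (P * x) + j * x ≡ suc P * ((P + j) * x)
  e₁ = solve-∀
  e₂ : ∀ P x → suc P * (P * x) ≡ P * (suc P * x)
  e₂ = solve-∀

-- Cubes and the numerical inequality behind the choice of a.

cube : ℕ → ℕ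
cube x = x * x * x

cube-mono : ∀ {a b} → a ≤ b → cube a ≤ cube b
cube-mono a≤b = *-mono-≤ (*-mono-≤ a≤b a≤b) a≤b

cube-* : ∀ a b → cube (a * b) ≡ cube a * cube b
cube-* = expand
  where
  expand : ∀ a b → a * b * (a * b) * (a * b) ≡ a * a * a * (b * b * b)
  expand = solve-∀

cube-^ : ∀ a n → cube (a ^ n) ≡ cube a ^ n
cube-^ a n = sym (trans (*-^ (a * a) a n) (cong (_* a ^ n) (*-^ a a n)))

cube-^-^ : ∀ a m n → cube (a ^ m) ^ n ≡ cube (a ^ n) ^ m
cube-^-^ a m n = begin
  cube (a ^ m) ^ n      ≡⟨ cong (_^ n) (cube-^ a m) ⟩
  (cube a ^ m) ^ n      ≡⟨ ^-*-assoc (cube a) m n ⟩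
  cube a ^ (m * n)      ≡⟨ cong (cube a ^_) (*-comm m n) ⟩
  cube a ^ (n * m)      ≡⟨ ^-*-assoc (cube a) n m ⟨
  (cube a ^ n) ^ m      ≡⟨ cong (_^ m) (cube-^ a n) ⟨
  cube (a ^ n) ^ m      ∎
  where open ≡-Reasoning

-- A bound v/u on the ratio s/t reduces the comparison of cubes to a check on numerals.
cube-≤ : ∀ u v a c s t → 0 < u → u * s ≤ v * t → a * cube v ≤ cube u * c →
         a * cube s ≤ c * cube t
cube-≤ u v a c s t 0<u us≤vt av³≤u³c = cancelˡ (*-pos (*-pos 0<u 0<u) 0<u) (begin
  cube u * (a * cube s)         ≡⟨ e₁ u a s ⟩
  a * cube (u * s)              ≤⟨ *-monoʳ-≤ a (cube-mono us≤vt) ⟩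
  a * cube (v * t)              ≡⟨ e₂ a v t ⟩
  a * cube v * cube t           ≤⟨ *-monoˡ-≤ (cube t) av³≤u³c ⟩
  cube u * c * cube t           ≡⟨ *-assoc (cube u) c (cube t) ⟩
  cube u * (c * cube t)         ∎)
  where
  open ≤-Reasoning
  e₁ : ∀ u a s → u * u * u * (a * (s * s * s)) ≡ a * (u * s * (u * s) * (u * s))
  e₁ = solve-∀
  e₂ : ∀ a v t → a * (v * t * (v * t) * (v * t)) ≡ a * (v * v * v) * (t * t * t)
  e₂ = solve-∀

-- For p = P/D the conclusion reads a ≤ c(p + p² + p³). The right side increases with p, so a check
-- at p = v/u suffices.
geometric-≤ : ∀ u v a c D P → 0 < u → v * D ≤ u * P → cube u * a ≤ c * (v * (u * u + u * v + v * v)) →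
              a * cube D ≤ c * (P * (D * D + D * P + P * P))
geometric-≤ u v a c D P 0<u vD≤uP u³a≤ = cancelˡ (*-pos (*-pos 0<u 0<u) 0<u) (begin
  cube u * (a * cube D)                                 ≡⟨ *-assoc (cube u) a (cube D) ⟨
  cube u * a * cube D                                   ≤⟨ *-monoˡ-≤ (cube D) u³a≤ ⟩
  c * (v * (u * u + u * v + v * v)) * cube D            ≡⟨ e₁ u v c D ⟩
  c * (v * D * (u * D * (u * D) + u * D * (v * D) + v * D * (v * D)))
    ≤⟨ *-monoʳ-≤ c (*-mono-≤ vD≤uP (+-mono-≤ (+-monoʳ-≤ (u * D * (u * D)) (*-monoʳ-≤ (u * D) vD≤uP)) (square-mono vD≤uP))) ⟩
  c * (u * P * (u * D * (u * D) + u * D * (u * P) + u * P * (u * P)))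
                                                        ≡⟨ e₂ u c P D ⟩
  cube u * (c * (P * (D * D + D * P + P * P)))          ∎)
  where
  open ≤-Reasoning
  e₁ : ∀ u v c D → c * (v * (u * u + u * v + v * v)) * (D * D * D) ≡
       c * (v * D * (u * D * (u * D) + u * D * (v * D) + v * D * (v * D)))
  e₁ = solve-∀
  e₂ : ∀ u c P D → c * (u * P * (u * D * (u * D) + u * D * (u * P) + u * P * (u * P))) ≡
       u * u * u * (c * (P * (D * D + D * P + P * P)))
  e₂ = solve-∀

-- Here D = 6(k + j), so that 7j/D is the chosen a, P/D is p, and W/D³ is p + p² + p³.
module KeyInequality (k j P : ℕ) (P+j≡6k : P + j ≡ 6 * k) (4j≤k : 4 * j ≤ k) (0<k : 0 < k) where

  private
    D = P + 7 * j
    W = P * (D * D + D * P + P * P)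
    S = suc P
    d = suc P ∸ k

  open ≤-Reasoning

  -- The extreme case is k = 4j, where k : P : D = 4 : 5.75 : 7.5 in units of j; this fixes the
  -- numerals below.
  23k≤4P : 23 * k ≤ 4 * P
  23k≤4P = +-cancelʳ-≤ k (23 * k) (4 * P) (begin
    23 * k + k          ≡⟨ e₁ k ⟩
    4 * (6 * k)         ≡⟨ cong (4 *_) P+j≡6k ⟨
    4 * (P + j)         ≡⟨ *-distribˡ-+ 4 P j ⟩
    4 * P + 4 * j       ≤⟨ +-monoʳ-≤ (4 * P) 4j≤k ⟩
    4 * P + k           ∎)
    where
    e₁ : ∀ k → 23 * k + k ≡ 4 * (6 * k)
    e₁ = solve-∀

  0<P : 0 < P
  0<P = pos-*ʳ 4 (<-≤-trans (*-pos (z<s {22}) 0<k) 23k≤4P)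

  23D≤30P : 23 * D ≤ 30 * P
  23D≤30P = begin
    23 * (P + 7 * j)            ≡⟨ e₁ P j ⟩
    23 * P + 161 * j            ≤⟨ +-monoʳ-≤ (23 * P) 161j≤7P ⟩
    23 * P + 7 * P              ≡⟨ *-distribʳ-+ P 23 7 ⟨
    30 * P                      ∎
    where
    e₁ : ∀ P j → 23 * (P + 7 * j) ≡ 23 * P + 161 * j
    e₁ P j = trans (*-distribˡ-+ 23 P (7 * j)) (cong (23 * P +_) (sym (*-assoc 23 7 j)))
    e₂ : ∀ a b j → a * (b * j) ≡ b * (a * j)
    e₂ = solve-∀
    161j≤7P : 161 * j ≤ 7 * P
    161j≤7P = *-cancelˡ-≤ 4 (begin
      4 * (161 * j)     ≡⟨ e₂ 4 161 j ⟩
      161 * (4 * j)     ≤⟨ *-monoʳ-≤ 161 4j≤k ⟩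
      161 * k           ≡⟨ *-assoc 7 23 k ⟩
      7 * (23 * k)      ≤⟨ *-monoʳ-≤ 7 23k≤4P ⟩
      7 * (4 * P)       ≡⟨ e₂ 7 4 P ⟩
      4 * (7 * P)       ∎)

  k+d≡S : k + d ≡ S
  k+d≡S = m+[n∸m]≡n (≤-trans k≤P (n≤1+n P))
    where
    k≤P : k ≤ P
    k≤P = *-cancelˡ-≤ 4 (≤-trans (*-monoˡ-≤ k (m≤m+n 4 19)) 23k≤4P)

  19S≤23d : 19 * S ≤ 23 * d
  19S≤23d = +-cancelʳ-≤ (23 * k) (19 * S) (23 * d) (begin
    19 * S + 23 * k     ≤⟨ +-monoʳ-≤ (19 * S) (≤-trans 23k≤4P (*-monoʳ-≤ 4 (n≤1+n P))) ⟩
    19 * S + 4 * S      ≡⟨ *-distribʳ-+ S 19 4 ⟨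
    23 * S              ≡⟨ cong (23 *_) k+d≡S ⟨
    23 * (k + d)        ≡⟨ e₁ k d ⟩
    23 * d + 23 * k     ∎)
    where
    e₁ : ∀ k d → 23 * (k + d) ≡ 23 * d + 23 * k
    e₁ = solve-∀

  -- As k/S ≤ 4/23, Bernoulli gives (1 - 1/S)^k ≥ 19/23.
  19Sᵏ≤23Pᵏ : 19 * S ^ k ≤ 23 * P ^ k
  19Sᵏ≤23Pᵏ = *-cancelʳ-≤ _ _ S (begin
    19 * S ^ k * S      ≡⟨ e₁ 19 (S ^ k) S ⟩
    S ^ k * (19 * S)    ≤⟨ *-monoʳ-≤ (S ^ k) 19S≤23d ⟩
    S ^ k * (23 * d)    ≡⟨ e₂ (S ^ k) 23 d ⟩
    23 * (S ^ k * d)    ≤⟨ *-monoʳ-≤ 23 (bernoulli-lower P k d k+d≡S) ⟩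
    23 * (P ^ k * S)    ≡⟨ *-assoc 23 (P ^ k) S ⟨
    23 * P ^ k * S      ∎)
    where
    e₁ : ∀ c a b → c * a * b ≡ a * (c * b)
    e₁ = solve-∀
    e₂ : ∀ a c b → a * (c * b) ≡ c * (a * b)
    e₂ = solve-∀

  -- (23/19)³ ≤ 9/5.
  5S³ᵏ≤9P³ᵏ : 5 * cube (S ^ k) ≤ 9 * cube (P ^ k)
  5S³ᵏ≤9P³ᵏ = cube-≤ 19 23 5 9 (S ^ k) (P ^ k) z<s 19Sᵏ≤23Pᵏ (≤ᵇ⇒≤ _ _ _)

  -- p + p² + p³ ≥ 9/5 for p ≥ 23/30.
  9D³≤5W : 9 * cube D ≤ 5 * W
  9D³≤5W = geometric-≤ 30 23 9 5 D P z<s 23D≤30P (≤ᵇ⇒≤ _ _ _)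

  -- Bernoulli trades exponents: 6k/P = 1 + j/P ≤ (S/P)^j, so (6k/P)^(3k) is at most the j-th power
  -- of (S/P)^(3k) ≤ 9/5. This is matched by p + p² + p³ ≥ 9/5.
  key : cube (6 * k) ^ k * cube D ^ j ≤ cube P ^ k * W ^ j
  key = cancelˡ (*-pos (^-pos k (*-pos (*-pos 0<Pʲ 0<Pʲ) 0<Pʲ)) (^-pos j (z<s {4}))) (begin
    cube (P ^ j) ^ k * 5 ^ j * (cube (6 * k) ^ k * cube D ^ j)
      ≡⟨ cong (λ n → cube (P ^ j) ^ k * 5 ^ j * (cube n ^ k * cube D ^ j)) P+j≡6k ⟨
    cube (P ^ j) ^ k * 5 ^ j * (cube (P + j) ^ k * cube D ^ j)
      ≡⟨ e₁ (cube (P ^ j) ^ k) (5 ^ j) (cube (P + j) ^ k) (cube D ^ j) ⟩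
    cube (P + j) ^ k * cube (P ^ j) ^ k * 5 ^ j * cube D ^ j
      ≡⟨ cong (λ t → t * 5 ^ j * cube D ^ j) (cube-*-^ (P + j) (P ^ j)) ⟨
    cube ((P + j) * P ^ j) ^ k * 5 ^ j * cube D ^ j
      ≤⟨ *-monoˡ-≤ (cube D ^ j) (*-monoˡ-≤ (5 ^ j) (^-monoˡ-≤ k (cube-mono (bernoulli-upper P j)))) ⟩
    cube (P * S ^ j) ^ k * 5 ^ j * cube D ^ j
      ≡⟨ cong (λ t → t * 5 ^ j * cube D ^ j) (cube-*-^ P (S ^ j)) ⟩
    cube P ^ k * cube (S ^ j) ^ k * 5 ^ j * cube D ^ j
      ≡⟨ cong (λ t → cube P ^ k * t * 5 ^ j * cube D ^ j) (cube-^-^ S j k) ⟩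
    cube P ^ k * cube (S ^ k) ^ j * 5 ^ j * cube D ^ j
      ≡⟨ e₂ (cube P ^ k) (cube (S ^ k) ^ j) (5 ^ j) (cube D ^ j) ⟩
    cube P ^ k * (5 ^ j * cube (S ^ k) ^ j) * cube D ^ j
      ≡⟨ cong (λ t → cube P ^ k * t * cube D ^ j) (*-^ 5 (cube (S ^ k)) j) ⟨
    cube P ^ k * (5 * cube (S ^ k)) ^ j * cube D ^ j
      ≤⟨ *-monoˡ-≤ (cube D ^ j) (*-monoʳ-≤ (cube P ^ k) (^-monoˡ-≤ j 5S³ᵏ≤9P³ᵏ)) ⟩
    cube P ^ k * (9 * cube (P ^ k)) ^ j * cube D ^ j
      ≡⟨ cong (λ t → cube P ^ k * t * cube D ^ j) (*-^ 9 (cube (P ^ k)) j) ⟩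
    cube P ^ k * (9 ^ j * cube (P ^ k) ^ j) * cube D ^ j
      ≡⟨ e₃ (cube P ^ k) (9 ^ j) (cube (P ^ k) ^ j) (cube D ^ j) ⟩
    cube (P ^ k) ^ j * cube P ^ k * (9 ^ j * cube D ^ j)
      ≡⟨ cong (cube (P ^ k) ^ j * cube P ^ k *_) (*-^ 9 (cube D) j) ⟨
    cube (P ^ k) ^ j * cube P ^ k * (9 * cube D) ^ j
      ≤⟨ *-monoʳ-≤ (cube (P ^ k) ^ j * cube P ^ k) (^-monoˡ-≤ j 9D³≤5W) ⟩
    cube (P ^ k) ^ j * cube P ^ k * (5 * W) ^ j
      ≡⟨ cong₂ (λ s t → s * cube P ^ k * t) (cube-^-^ P k j) (*-^ 5 W j) ⟩
    cube (P ^ j) ^ k * cube P ^ k * (5 ^ j * W ^ j)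
      ≡⟨ e₄ (cube (P ^ j) ^ k) (cube P ^ k) (5 ^ j) (W ^ j) ⟩
    cube (P ^ j) ^ k * 5 ^ j * (cube P ^ k * W ^ j)     ∎)
    where
    0<Pʲ : 0 < P ^ j
    0<Pʲ = ^-pos j 0<P
    cube-*-^ : ∀ a b → cube (a * b) ^ k ≡ cube a ^ k * cube b ^ k
    cube-*-^ a b = trans (cong (_^ k) (cube-* a b)) (*-^ (cube a) (cube b) k)
    e₁ : ∀ a b c d → a * b * (c * d) ≡ c * a * b * d
    e₁ = solve-∀
    e₂ : ∀ a b c d → a * b * c * d ≡ a * (c * b) * d
    e₂ = solve-∀
    e₃ : ∀ a b c d → a * (b * c) * d ≡ c * a * (b * d)
    e₃ = solve-∀
    e₄ : ∀ a b c d → a * b * (c * d) ≡ a * c * (b * d)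
    e₄ = solve-∀

-- Binomial coefficients

C-absorption : ∀ n j → suc j * (suc n C suc j) ≡ suc n * (n C j)
C-absorption zero    zero    = refl
C-absorption zero    (suc j) = trans (cong ((2 + j) *_) (k>n⇒nCk≡0 (s≤s (z<s {j})))) (*-zeroʳ (2 + j))
C-absorption (suc n) zero    = begin
  1 * (suc (suc n) C 1)                     ≡⟨ cong (1 *_) (nCk+nC[k+1]≡[n+1]C[k+1] (suc n) 0) ⟨
  1 * (1 + (suc n C 1))                 ≡⟨ *-distribˡ-+ 1 1 (suc n C 1) ⟩
  1 * 1 + 1 * (suc n C 1)               ≡⟨ cong (1 * 1 +_) (C-absorption n 0) ⟩
  1 * 1 + suc n * 1                     ∎
  where open ≡-Reasoning
C-absorption (suc n) (suc j) = begin
  suc (suc j) * (suc (suc n) C suc (suc j))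
    ≡⟨ cong (suc (suc j) *_) (nCk+nC[k+1]≡[n+1]C[k+1] (suc n) (suc j)) ⟨
  suc (suc j) * (c + c₂)                ≡⟨ e₁ (suc j) c c₂ ⟩
  c + (suc j * c + suc (suc j) * c₂)    ≡⟨ cong (c +_) (cong₂ _+_ (C-absorption n j) (C-absorption n (suc j))) ⟩
  c + (suc n * (n C j) + suc n * (n C suc j))
                                        ≡⟨ cong (c +_) (*-distribˡ-+ (suc n) (n C j) (n C suc j)) ⟨
  c + suc n * ((n C j) + (n C suc j))   ≡⟨ cong (λ t → c + suc n * t) (nCk+nC[k+1]≡[n+1]C[k+1] n j) ⟩
  suc (suc n) * c                       ∎
  where
  open ≡-Reasoning
  c = suc n C suc j
  c₂ = suc n C suc (suc j)
  e₁ : ∀ s c d → suc s * (c + d) ≡ c + (s * c + suc s * d)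
  e₁ = solve-∀

C-ratio : ∀ n i l → i + suc l ≡ n → suc i * (n C suc i) ≡ suc l * (n C i)
C-ratio n i l eq = +-cancelˡ-≡ (suc i * (n C i)) _ _ (begin
  suc i * (n C i) + suc i * (n C suc i) ≡⟨ *-distribˡ-+ (suc i) (n C i) (n C suc i) ⟨
  suc i * ((n C i) + (n C suc i))       ≡⟨ cong (suc i *_) (nCk+nC[k+1]≡[n+1]C[k+1] n i) ⟩
  suc i * (suc n C suc i)               ≡⟨ C-absorption n i ⟩
  suc n * (n C i)                       ≡⟨ cong (λ m → suc m * (n C i)) eq ⟨
  (suc i + suc l) * (n C i)             ≡⟨ *-distribʳ-+ (n C i) (suc i) (suc l) ⟩
  suc i * (n C i) + suc l * (n C i)     ∎)
  where open ≡-Reasoning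

-- The largest term of the binomial expansion of (j + k)^(j + k).

module LargestTerm (k j : ℕ) where

  private
    n = j + k

  term : ℕ → ℕ → ℕ
  term i l = (n C i) * (j ^ i * k ^ l)

  open ≤-Reasoning

  ratio : ∀ i l → i + suc l ≡ n → suc i * term (suc i) l ≡ suc l * (n C i) * (j * j ^ i * k ^ l)
  ratio i l eq = trans (sym (*-assoc (suc i) (n C suc i) _)) (cong (_* (j * j ^ i * k ^ l)) (C-ratio n i l eq))

  -- Consecutive terms have ratio (l+1)j / ((i+1)k), so the terms rise up to i = j and fall from
  -- there on.
  increasing : ∀ i l → i + suc l ≡ n → suc i * k ≤ suc l * j → term i (suc l) ≤ term (suc i) l
  increasing i l eq h = *-cancelˡ-≤ (suc i) (begin
    suc i * term i (suc l)                              ≡⟨ e₁ (suc i) (n C i) (j ^ i) k (k ^ l) ⟩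
    suc i * k * ((n C i) * (j ^ i * k ^ l))             ≤⟨ *-monoˡ-≤ _ h ⟩
    suc l * j * ((n C i) * (j ^ i * k ^ l))             ≡⟨ e₂ (suc l) j (n C i) (j ^ i) (k ^ l) ⟩
    suc l * (n C i) * (j * j ^ i * k ^ l)               ≡⟨ ratio i l eq ⟨
    suc i * term (suc i) l                              ∎)
    where
    e₁ : ∀ s c x k y → s * (c * (x * (k * y))) ≡ s * k * (c * (x * y))
    e₁ = solve-∀
    e₂ : ∀ s j c x y → s * j * (c * (x * y)) ≡ s * c * (j * x * y)
    e₂ = solve-∀

  decreasing : ∀ i l → i + suc l ≡ n → suc l * j ≤ suc i * k → term (suc i) l ≤ term i (suc l)
  decreasing i l eq h = *-cancelˡ-≤ (suc i) (begin
    suc i * term (suc i) l                              ≡⟨ ratio i l eq ⟩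
    suc l * (n C i) * (j * j ^ i * k ^ l)               ≡⟨ e₂ (suc l) j (n C i) (j ^ i) (k ^ l) ⟩
    suc l * j * ((n C i) * (j ^ i * k ^ l))             ≤⟨ *-monoˡ-≤ _ h ⟩
    suc i * k * ((n C i) * (j ^ i * k ^ l))             ≡⟨ e₁ (suc i) (n C i) (j ^ i) k (k ^ l) ⟩
    suc i * term i (suc l)                              ∎)
    where
    e₁ : ∀ s c x k y → s * k * (c * (x * y)) ≡ s * (c * (x * (k * y)))
    e₁ = solve-∀
    e₂ : ∀ s j c x y → s * c * (j * x * y) ≡ s * j * (c * (x * y))
    e₂ = solve-∀

  term-below : ∀ d i → d + i ≡ j → term i (d + k) ≤ term j k
  term-below zero    i refl = ≤-refl
  term-below (suc d) i eq   = ≤-trans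
    (increasing i (d + k) sum≡n (begin
      suc i * k             ≤⟨ *-mono-≤ (m+n≤o⇒n≤o d (≤-reflexive d+1+i≡j)) (≤-trans (m≤n+m k d) (n≤1+n (d + k))) ⟩
      j * suc (d + k)       ≡⟨ *-comm j _ ⟩
      suc (d + k) * j       ∎))
    (term-below d (suc i) d+1+i≡j)
    where
    d+1+i≡j : d + suc i ≡ j
    d+1+i≡j = trans (+-suc d i) eq
    sum≡n : i + suc (d + k) ≡ n
    sum≡n = trans (e i d k) (cong (_+ k) eq)
      where
      e : ∀ i d k → i + suc (d + k) ≡ suc (d + i) + k
      e = solve-∀

  term-above : ∀ d l → d + l ≡ k → term (d + j) l ≤ term j k
  term-above zero    l refl = ≤-refl
  term-above (suc d) l eq   = ≤-trans
    (decreasing (d + j) l sum≡n (begin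
      suc l * j             ≤⟨ *-mono-≤ (m+n≤o⇒n≤o d (≤-reflexive d+1+l≡k)) (≤-trans (m≤n+m j d) (n≤1+n (d + j))) ⟩
      k * suc (d + j)       ≡⟨ *-comm k _ ⟩
      suc (d + j) * k       ∎))
    (term-above d (suc l) d+1+l≡k)
    where
    d+1+l≡k : d + suc l ≡ k
    d+1+l≡k = trans (+-suc d l) eq
    sum≡n : d + j + suc l ≡ n
    sum≡n = trans (e j d l) (cong (j +_) eq)
      where
      e : ∀ j d l → d + j + suc l ≡ j + suc (d + l)
      e = solve-∀

  term≤largest : ∀ i → i ≤ n → term i (n ∸ i) ≤ term j k
  term≤largest i i≤n with ≤-total i j
  ... | inj₁ i≤j = subst (λ l → term i l ≤ term j k) (sym (+-∸-comm k i≤j)) (term-below (j ∸ i) i (m∸n+n≡m i≤j))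
  ... | inj₂ j≤i = subst (λ i′ → term i′ (n ∸ i) ≤ term j k) (m∸n+n≡m j≤i) (term-above (i ∸ j) (n ∸ i)
                     (+-cancelˡ-≡ j _ _ (trans (sym (+-assoc j (i ∸ j) (n ∸ i)))
                       (trans (cong (_+ (n ∸ i)) (m+[n∸m]≡n j≤i)) (m+[n∸m]≡n i≤n)))))

  private
    open module ℕ-binomial = Binomial +-*-commutativeSemiring using (theorem; binomialTerm; binomialExpansion)
    module ℕ-semiring = RawSemiring (CommutativeSemiring.rawSemiring +-*-commutativeSemiring)

    ^≡^ : ∀ a m → a ℕ-semiring.^ m ≡ a ^ m
    ^≡^ a zero    = refl
    ^≡^ a (suc m) = cong (a *_) (^≡^ a m)

    ×≡* : ∀ m a → m ℕ-semiring.× a ≡ m * a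
    ×≡* zero    a = refl
    ×≡* (suc m) a = cong (a +_) (×≡* m a)

    sum-≤ : ∀ m (f : Fin m → ℕ) T → (∀ i → f i ≤ T) → ℕ-semiring.sum f ≤ m * T
    sum-≤ zero    f T f≤T = z≤n
    sum-≤ (suc m) f T f≤T = +-mono-≤ (f≤T zero) (sum-≤ m (λ i → f (suc i)) T (λ i → f≤T (suc i)))

    binomialTerm≡term : ∀ i → binomialTerm j k n i ≡ term (toℕ i) (n ∸ toℕ i)
    binomialTerm≡term i = trans (×≡* (n C toℕ i) _) (cong ((n C toℕ i) *_) (cong₂ _*_ (^≡^ j (toℕ i)) (^≡^ k (n ∸ toℕ i))))

  -- Each of the n + 1 terms is at most the one at i = j. This bounds the binomial coefficient from
  -- below up to a polynomial factor.
  power≤largest : (j + k) ^ n ≤ suc n * term j k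
  power≤largest = begin
    (j + k) ^ n                     ≡⟨ ^≡^ (j + k) n ⟨
    (j + k) ℕ-semiring.^ n          ≡⟨ theorem n j k ⟩
    binomialExpansion j k n         ≤⟨ sum-≤ (suc n) _ _ (λ i → ≤-trans (≤-reflexive (binomialTerm≡term i))
                                                                     (term≤largest (toℕ i) (Fin.toℕ≤pred[n] i))) ⟩
    suc n * term j k                ∎

-- Induction on the blue clique

-- Raising j by one multiplies the binomial coefficient by (k+j+1)/(j+1), which is at least 7/6.
-- Thus the bound in `Big` never falls below its polynomial factor.
7^j≤6^jC : ∀ k j → 4 * j ≤ k → 7 ^ j ≤ 6 ^ j * ((k + j) C j)
7^j≤6^jC k zero    _    = ≤-refl
7^j≤6^jC k (suc j) 4j≤k = *-cancelˡ-≤ (suc j) (begin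
  suc j * (7 * 7 ^ j)                           ≡⟨ e₁ (suc j) 7 (7 ^ j) ⟩
  7 * suc j * 7 ^ j                             ≤⟨ *-mono-≤ 7j≤6[k+j] (7^j≤6^jC k j (≤-trans (*-monoʳ-≤ 4 (n≤1+n j)) 4j≤k)) ⟩
  6 * suc (k + j) * (6 ^ j * ((k + j) C j))       ≡⟨ e₂ 6 (suc (k + j)) (6 ^ j) ((k + j) C j) ⟩
  6 * 6 ^ j * (suc (k + j) * ((k + j) C j))       ≡⟨ cong (6 * 6 ^ j *_) (C-absorption (k + j) j) ⟨
  6 * 6 ^ j * (suc j * (suc (k + j) C suc j))   ≡⟨ e₃ (6 * 6 ^ j) (suc j) (suc (k + j) C suc j) ⟩
  suc j * (6 * 6 ^ j * (suc (k + j) C suc j))   ≡⟨ cong (λ n → suc j * (6 * 6 ^ j * (n C suc j))) (+-suc k j) ⟨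
  suc j * (6 * 6 ^ j * ((k + suc j) C suc j))     ∎)
  where
  open ≤-Reasoning
  e₁ : ∀ s c x → s * (c * x) ≡ c * s * x
  e₁ = solve-∀
  e₂ : ∀ c n x b → c * n * (x * b) ≡ c * x * (n * b)
  e₂ = solve-∀
  e₃ : ∀ x s c → x * (s * c) ≡ s * (x * c)
  e₃ = solve-∀
  7j≤6[k+j] : 7 * suc j ≤ 6 * suc (k + j)
  7j≤6[k+j] = begin
    suc j + 6 * suc j       ≤⟨ +-monoˡ-≤ (6 * suc j) (≤-trans (m≤m+n (suc j) (3 * suc j)) (≤-trans 4j≤k (m≤m+n k (5 * k)))) ⟩
    6 * k + 6 * suc j       ≡⟨ *-distribˡ-+ 6 k (suc j) ⟨
    6 * (k + suc j)         ≡⟨ cong (6 *_) (+-suc k j) ⟩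
    6 * suc (k + j)         ∎

-- The cube of 32 is 2³ · 64 · 8², the product of the constants lost in the verification; the ninth
-- power of k + 1 in the cube of `B k` covers the seventh power lost there.
B : ℕ → ℕ
B k = 32 * cube (suc k)

-- n ≥ B k (6/7)^j C(k+j, j) (1 + 1/k)^j, whose last factor absorbs the one lost in blue-degree below.
Big : ℕ → ℕ → ℕ → Set
Big k j n = B k * ((6 * suc k) ^ j * ((k + j) C j)) ≤ n * (7 * k) ^ j

Big? : ∀ k j n → Dec (Big k j n)
Big? k j n = B k * ((6 * suc k) ^ j * ((k + j) C j)) ≤? n * (7 * k) ^ j

0<B : ∀ k → 0 < B k
0<B k = *-pos {32} z<s (*-pos {suc k * suc k} {suc k} (*-pos {suc k} {suc k} z<s z<s) z<s)

-- The size of n against the requirement of the book argument.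

module Verification
  (k j n P m : ℕ) (0<k : 0 < k) (0<j : 0 < j) (4j≤k : 4 * j ≤ k) (P+j≡6k : P + j ≡ 6 * k)
  (2[k+j]≤1+m : 2 * (k + j) ≤ suc m) (1+m≤8[1+k] : suc m ≤ 8 * suc k) (big : Big k j n) where

  open Parameters P (7 * j) m
  open KeyInequality k j P P+j≡6k 4j≤k 0<k using (key; 0<P) public
  open ≤-Reasoning

  private
    A = 7 * j
    T = (k + j) C j
    W = P * (D * D + D * P + P * P)

  D≡6[k+j] : D ≡ 6 * (k + j)
  D≡6[k+j] = trans (sym (+-assoc P j (6 * j))) (trans (cong (_+ 6 * j) P+j≡6k) (sym (*-distribˡ-+ 6 k j)))

  j≤k : j ≤ k
  j≤k = ≤-trans (m≤m+n j (3 * j)) 4j≤k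

  big′ : B k * (6 ^ j * T) ≤ n * 7 ^ j
  big′ = cancelˡ (^-pos j 0<k) (begin
    k ^ j * (B k * (6 ^ j * T))         ≤⟨ *-monoˡ-≤ _ (^-monoˡ-≤ j (n≤1+n k)) ⟩
    suc k ^ j * (B k * (6 ^ j * T))     ≡⟨ e₁ (suc k ^ j) (B k) (6 ^ j) T ⟩
    B k * (6 ^ j * suc k ^ j * T)       ≡⟨ cong (λ x → B k * (x * T)) (*-^ 6 (suc k) j) ⟨
    B k * ((6 * suc k) ^ j * T)         ≤⟨ big ⟩
    n * (7 * k) ^ j                     ≡⟨ cong (n *_) (*-^ 7 k j) ⟩
    n * (7 ^ j * k ^ j)                 ≡⟨ e₂ n (7 ^ j) (k ^ j) ⟩
    k ^ j * (n * 7 ^ j)                 ∎)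
    where
    e₁ : ∀ s b x t → s * (b * (x * t)) ≡ b * (x * s * t)
    e₁ = solve-∀
    e₂ : ∀ n x y → n * (x * y) ≡ y * (n * x)
    e₂ = solve-∀

  B≤n : B k ≤ n
  B≤n = *-cancelʳ-≤ (B k) n (7 ^ j) {{m^n≢0 7 j}} (≤-trans (*-monoʳ-≤ (B k) (7^j≤6^jC k j 4j≤k)) big′)

  -- Pays for each vertex being absent from its own two neighbourhoods when red degrees are
  -- estimated.
  2[1+k]D≤nA : 2 * suc k * D ≤ n * A
  2[1+k]D≤nA = begin
    2 * suc k * D                       ≡⟨ cong (2 * suc k *_) D≡6[k+j] ⟩
    2 * suc k * (6 * (k + j))           ≤⟨ *-monoʳ-≤ (2 * suc k) (*-monoʳ-≤ 6 (+-mono-≤ (n≤1+n k) (≤-trans j≤k (n≤1+n k)))) ⟩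
    2 * suc k * (6 * (suc k + suc k))   ≡⟨ e₁ (suc k) ⟩
    24 * (suc k * suc k)                ≤⟨ *-mono-≤ (m≤m+n 24 8) (m≤m*n (suc k * suc k) (suc k)) ⟩
    B k                                 ≤⟨ B≤n ⟩
    n                                   ≤⟨ m≤m*n n A {{>-nonZero (*-pos (z<s {6}) 0<j)}} ⟩
    n * A                               ∎
    where
    e₁ : ∀ s → 2 * s * (6 * (s + s)) ≡ 24 * (s * s)
    e₁ = solve-∀

  private
    v = n * (A ^ j * (6 * k) ^ k)

  -- The largest-term estimate replaces the binomial coefficient in `big′` by pure powers, and the
  -- powers of 7 and 6 complete j^j and k^k to A^j and (6k)^k.
  B·Dᵏ⁺ʲ≤v : B k * D ^ (k + j) ≤ suc (k + j) * v
  B·Dᵏ⁺ʲ≤v = begin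
    B k * D ^ (k + j)                   ≡⟨ cong (λ x → B k * x ^ (k + j)) D≡6[k+j] ⟩
    B k * (6 * (k + j)) ^ (k + j)       ≡⟨ cong (B k *_) (*-^ 6 (k + j) (k + j)) ⟩
    B k * (6 ^ (k + j) * (k + j) ^ (k + j))
      ≤⟨ *-monoʳ-≤ (B k) (*-monoʳ-≤ (6 ^ (k + j)) entropy) ⟩
    B k * (6 ^ (k + j) * (suc (k + j) * (T * (j ^ j * k ^ k))))
      ≡⟨ cong (λ x → B k * (x * (suc (k + j) * (T * (j ^ j * k ^ k))))) (^-distribˡ-+-* 6 k j) ⟩
    B k * (6 ^ k * 6 ^ j * (suc (k + j) * (T * (j ^ j * k ^ k))))
      ≡⟨ e₁ (B k) (6 ^ k) (6 ^ j) (suc (k + j)) T (j ^ j) (k ^ k) ⟩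
    suc (k + j) * (j ^ j * (6 ^ k * k ^ k)) * (B k * (6 ^ j * T))
      ≤⟨ *-monoʳ-≤ (suc (k + j) * (j ^ j * (6 ^ k * k ^ k))) big′ ⟩
    suc (k + j) * (j ^ j * (6 ^ k * k ^ k)) * (n * 7 ^ j)
      ≡⟨ e₂ (suc (k + j)) (j ^ j) (6 ^ k * k ^ k) n (7 ^ j) ⟩
    suc (k + j) * (n * (7 ^ j * j ^ j * (6 ^ k * k ^ k)))
      ≡⟨ cong₂ (λ x y → suc (k + j) * (n * (x * y))) (*-^ 7 j j) (*-^ 6 k k) ⟨
    suc (k + j) * v                     ∎
    where
    entropy : (k + j) ^ (k + j) ≤ suc (k + j) * (T * (j ^ j * k ^ k))
    entropy = subst (λ n → n ^ n ≤ suc n * ((n C j) * (j ^ j * k ^ k))) (+-comm j k) (LargestTerm.power≤largest k j)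
    e₁ : ∀ b x y s t u w → b * (x * y * (s * (t * (u * w)))) ≡ s * (u * (x * w)) * (b * (y * t))
    e₁ = solve-∀
    e₂ : ∀ s u x n y → s * (u * x) * (n * y) ≡ s * (n * (y * u * x))
    e₂ = solve-∀

  64[1+k]²L²·D³⁽ᵏ⁺ʲ⁾≤v³ : 64 * (suc k * suc k) * (L * L) * cube (D ^ (k + j)) ≤ cube v
  64[1+k]²L²·D³⁽ᵏ⁺ʲ⁾≤v³ = *-cancelˡ-≤ (cube (suc (k + j))) (begin
    cube (suc (k + j)) * (64 * (suc k * suc k) * (L * L) * cube (D ^ (k + j)))
      ≤⟨ *-mono-≤ (cube-mono 1+k+j≤2[1+k]) (*-monoˡ-≤ (cube (D ^ (k + j))) (*-monoʳ-≤ (64 * (suc k * suc k)) (square-mono 1+m≤8[1+k]))) ⟩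
    cube (2 * suc k) * (64 * (suc k * suc k) * (8 * suc k * (8 * suc k)) * cube (D ^ (k + j)))
      ≡⟨ e₁ 2 64 8 (suc k) (cube (D ^ (k + j))) ⟩
    cube 2 * 64 * (8 * 8) * (cube (suc k) * (cube (suc k) * suc k)) * cube (D ^ (k + j))
      ≡⟨ cong (λ c → c * (cube (suc k) * (cube (suc k) * suc k)) * cube (D ^ (k + j))) constants ⟩
    cube 32 * (cube (suc k) * (cube (suc k) * suc k)) * cube (D ^ (k + j))
      ≤⟨ *-monoˡ-≤ (cube (D ^ (k + j))) (*-monoʳ-≤ (cube 32) (*-monoʳ-≤ (cube (suc k)) (*-monoʳ-≤ (cube (suc k)) (m≤m*n (suc k) (suc k * suc k))))) ⟩
    cube 32 * (cube (suc k) * (cube (suc k) * (suc k * (suc k * suc k)))) * cube (D ^ (k + j))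
      ≡⟨ e₂ 32 (suc k) (D ^ (k + j)) ⟩
    cube (B k * D ^ (k + j))            ≤⟨ cube-mono B·Dᵏ⁺ʲ≤v ⟩
    cube (suc (k + j) * v)              ≡⟨ cube-* (suc (k + j)) v ⟩
    cube (suc (k + j)) * cube v         ∎)
    where
    constants : cube 2 * 64 * (8 * 8) ≡ cube 32
    constants = refl
    1+k+j≤2[1+k] : suc (k + j) ≤ 2 * suc k
    1+k+j≤2[1+k] = ≤-trans (+-monoʳ-≤ (suc k) (≤-trans j≤k (n≤1+n k))) (≤-reflexive (cong (suc k +_) (sym (+-identityʳ (suc k)))))
    e₁ : ∀ a c b s d → a * s * (a * s) * (a * s) * (c * (s * s) * (b * s * (b * s)) * d) ≡
         a * a * a * c * (b * b) * (s * s * s * (s * s * s * s)) * d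
    e₁ = solve-∀
    e₂ : ∀ c s d → c * c * c * (s * s * s * (s * s * s * (s * (s * s)))) * (d * d * d) ≡
         c * (s * s * s) * d * (c * (s * s * s) * d) * (c * (s * s * s) * d)
    e₂ = solve-∀

  -- All k + j steps together lose at most a factor 4 to the chosen vertices, because L ≥ 2(k + j).
  L²-bound : (L * L) ^ (k + j) ≤ 4 * (m * m) ^ (k + j)
  L²-bound = begin
    (L * L) ^ (k + j)                           ≡⟨ *-^ L L (k + j) ⟩
    L ^ (k + j) * L ^ (k + j)                   ≤⟨ square-mono (bernoulli-double m (k + j) 2[k+j]≤1+m) ⟩
    2 * m ^ (k + j) * (2 * m ^ (k + j))         ≡⟨ e₁ (m ^ (k + j)) ⟩
    4 * (m ^ (k + j) * m ^ (k + j))             ≡⟨ cong (4 *_) (*-^ m m (k + j)) ⟨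
    4 * (m * m) ^ (k + j)                       ∎
    where
    e₁ : ∀ x → 2 * x * (2 * x) ≡ 4 * (x * x)
    e₁ = solve-∀

  -- Since 1 - p³ = a(1 + p + p²), the product pa²(1 - p³) is a³(p + p² + p³), which is where `W`
  -- enters.
  ρσβ≡ : ρ ^ k * σ ^ j * β ^ j ≡ cube A ^ j * (α ^ k * W ^ j) * (m * m) ^ (k + j)
  ρσβ≡ = begin-equality
    ρ ^ k * σ ^ j * β ^ j               ≡⟨ *-assoc (ρ ^ k) (σ ^ j) (β ^ j) ⟩
    ρ ^ k * (σ ^ j * β ^ j)             ≡⟨ cong (ρ ^ k *_) (*-^ σ β j) ⟨
    ρ ^ k * (σ * β) ^ j                 ≡⟨ cong (λ x → ρ ^ k * x ^ j) (e₁ A P m (D * D + D * P + P * P)) ⟩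
    ρ ^ k * (cube A * W * (m * m)) ^ j  ≡⟨ cong₂ _*_ (*-^ α (m * m) k) (trans (*-^ (cube A * W) (m * m) j) (cong (_* (m * m) ^ j) (*-^ (cube A) W j))) ⟩
    α ^ k * (m * m) ^ k * (cube A ^ j * W ^ j * (m * m) ^ j)
                                        ≡⟨ e₂ (α ^ k) ((m * m) ^ k) (cube A ^ j) (W ^ j) ((m * m) ^ j) ⟩
    cube A ^ j * (α ^ k * W ^ j) * ((m * m) ^ k * (m * m) ^ j)
                                        ≡⟨ cong (cube A ^ j * (α ^ k * W ^ j) *_) (^-distribˡ-+-* (m * m) k j) ⟨
    cube A ^ j * (α ^ k * W ^ j) * (m * m) ^ (k + j) ∎
    where
    e₁ : ∀ A P m q → A * A * P * (m * m) * (A * q) ≡ A * A * A * (P * q) * (m * m)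
    e₁ = solve-∀
    e₂ : ∀ a x b w y → a * x * (b * w * y) ≡ b * (a * w) * (x * y)
    e₂ = solve-∀

  -- By the lower bound on e, e²/n is of order n³ up to powers of A and k + 1; hence the cubed
  -- estimate for `v` applies, and `key` exchanges (6k)^(3k) D^(3j) for P^(3k) W^j.
  book-hypothesis : ∀ e → A * n * n ≤ 2 * suc k * e →
                    n * (K j * δ ^ (k + j)) ≤ e * e * (ρ ^ k * σ ^ j * β ^ j)
  book-hypothesis e e-large = *-cancelˡ-≤ (s * s) (begin
    s * s * (n * (K j * δ ^ (k + j)))
      ≡⟨ cong₂ (λ x y → s * s * (n * (4 * (L * L) * (A * A) * x ^ j * y))) α+β≡D³ (*-^ (cube D) (L * L) (k + j)) ⟩
    s * s * (n * (4 * (L * L) * (A * A) * cube D ^ j * (cube D ^ (k + j) * (L * L) ^ (k + j))))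
      ≤⟨ *-monoʳ-≤ (s * s) (*-monoʳ-≤ n (*-monoʳ-≤ (4 * (L * L) * (A * A) * cube D ^ j) (*-monoʳ-≤ (cube D ^ (k + j)) L²-bound))) ⟩
    s * s * (n * (4 * (L * L) * (A * A) * cube D ^ j * (cube D ^ (k + j) * (4 * M))))
      ≡⟨ cong (λ x → s * s * (n * (4 * (L * L) * (A * A) * cube D ^ j * (x * (4 * M))))) (cube-^ D (k + j)) ⟨
    s * s * (n * (4 * (L * L) * (A * A) * cube D ^ j * (cube (D ^ (k + j)) * (4 * M))))
      ≡⟨ e₁ (suc k) n L A (cube D ^ j) (cube (D ^ (k + j))) M ⟩
    A * A * n * cube D ^ j * M * (64 * (suc k * suc k) * (L * L) * cube (D ^ (k + j)))
      ≤⟨ *-monoʳ-≤ (A * A * n * cube D ^ j * M) 64[1+k]²L²·D³⁽ᵏ⁺ʲ⁾≤v³ ⟩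
    A * A * n * cube D ^ j * M * cube v
      ≡⟨ e₂ A n (cube D ^ j) M (A ^ j) ((6 * k) ^ k) ⟩
    A * n * n * (A * n * n) * (cube (A ^ j) * (cube ((6 * k) ^ k) * cube D ^ j) * M)
      ≡⟨ cong₂ (λ x y → A * n * n * (A * n * n) * (x * (y * cube D ^ j) * M)) (cube-^ A j) (cube-^ (6 * k) k) ⟩
    A * n * n * (A * n * n) * (cube A ^ j * (cube (6 * k) ^ k * cube D ^ j) * M)
      ≤⟨ *-monoʳ-≤ (A * n * n * (A * n * n)) (*-monoˡ-≤ M (*-monoʳ-≤ (cube A ^ j) key)) ⟩
    A * n * n * (A * n * n) * (cube A ^ j * (α ^ k * W ^ j) * M)
      ≡⟨ cong (A * n * n * (A * n * n) *_) ρσβ≡ ⟨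
    A * n * n * (A * n * n) * R         ≤⟨ *-monoˡ-≤ R (square-mono e-large) ⟩
    s * e * (s * e) * R                 ≡⟨ e₃ s e R ⟩
    s * s * (e * e * R)                 ∎)
    where
    s = 2 * suc k
    M = (m * m) ^ (k + j)
    R = ρ ^ k * σ ^ j * β ^ j
    e₁ : ∀ t n L A x y M → 2 * t * (2 * t) * (n * (4 * (L * L) * (A * A) * x * (y * (4 * M)))) ≡
         A * A * n * x * M * (64 * (t * t) * (L * L) * y)
    e₁ = solve-∀
    e₂ : ∀ A n x M a b → A * A * n * x * M * (n * (a * b) * (n * (a * b)) * (n * (a * b))) ≡
         A * n * n * (A * n * n) * (a * a * a * (b * b * b * x) * M)
    e₂ = solve-∀
    e₃ : ∀ s e R → s * e * (s * e) * R ≡ s * s * (e * e * R)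
    e₃ = solve-∀

-- Blue descent or high red density.

module _ {N : ℕ} (c : Colouring N) where

  open Graph c

  -- The factor k/(k+1) leaves room for a positive excess over the red density P/D, where A = D - P.
  blue-degree : ∀ k j n b → 0 < k → Big k (suc j) n → ¬ Big k j b →
                suc k * (6 * (k + suc j)) * b ≤ n * k * (7 * suc j)
  blue-degree k j n b 0<k big ¬big = cancelˡ (^-pos j (*-pos (z<s {6}) 0<k)) (begin
    (7 * k) ^ j * (suc k * (6 * (k + suc j)) * b)                       ≡⟨ e₁ ((7 * k) ^ j) (suc k) 6 (k + suc j) b ⟩
    6 * suc k * (k + suc j) * (b * (7 * k) ^ j)                         ≤⟨ *-monoʳ-≤ (6 * suc k * (k + suc j)) (<⇒≤ (≰⇒> ¬big)) ⟩
    6 * suc k * (k + suc j) * (B k * ((6 * suc k) ^ j * ((k + j) C j))) ≡⟨ e₂ (6 * suc k) (k + suc j) (B k) ((6 * suc k) ^ j) ((k + j) C j) ⟩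
    B k * ((6 * suc k) ^ suc j * ((k + suc j) * ((k + j) C j)))
      ≡⟨ cong (λ x → B k * ((6 * suc k) ^ suc j * x)) absorption ⟩
    B k * ((6 * suc k) ^ suc j * (suc j * ((k + suc j) C suc j)))
      ≡⟨ e₃ (B k) ((6 * suc k) ^ suc j) (suc j) ((k + suc j) C suc j) ⟩
    suc j * (B k * ((6 * suc k) ^ suc j * ((k + suc j) C suc j)))       ≤⟨ *-monoʳ-≤ (suc j) big ⟩
    suc j * (n * (7 * k) ^ suc j)                                       ≡⟨ e₄ (suc j) n 7 k ((7 * k) ^ j) ⟩
    (7 * k) ^ j * (n * k * (7 * suc j))                                 ∎)
    where
    open ≤-Reasoning
    absorption : (k + suc j) * ((k + j) C j) ≡ suc j * ((k + suc j) C suc j)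
    absorption rewrite +-suc k j = sym (C-absorption (k + j) j)
    e₁ : ∀ q s u t b → q * (s * (u * t) * b) ≡ u * s * t * (b * q)
    e₁ = solve-∀
    e₂ : ∀ s t b q c → s * t * (b * (q * c)) ≡ b * (s * q * (t * c))
    e₂ = solve-∀
    e₃ : ∀ b q s c → b * (q * (s * c)) ≡ s * (b * (q * c))
    e₃ = solve-∀
    e₄ : ∀ s n u k q → s * (n * (u * k * q)) ≡ q * (n * k * (u * s))
    e₄ = solve-∀

  module DenseCase (k j P m : ℕ) (0<k : 0 < k) (4j≤k : 4 * suc j ≤ k) (P+j≡6k : P + suc j ≡ 6 * k)
    (2[k+j]≤1+m : 2 * (k + suc j) ≤ suc m) (1+m≤8[1+k] : suc m ≤ 8 * suc k) (0<m : 0 < m)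
    (X : List (Fin N)) (X! : Unique X) (big : Big k (suc j) (length X))
    (¬blue : ∀ {v} → v ∈ X → ¬ Big k j (length (nbhd false v X))) where

    open ≤-Reasoning
    private
      n = length X
      A = 7 * suc j
      E = edges X X

    open Parameters P A m using (D)
    open Verification k (suc j) n P m 0<k z<s 4j≤k P+j≡6k 2[k+j]≤1+m 1+m≤8[1+k] big
    open Book c P A m (suc j) 0<P z<s 0<m

    degree : ∀ {v} → v ∈ X → 2 * suc k * D * n ≤ 2 * suc k * D * length (nbhd true v X) + (2 * (n * k * A) + n * A)
    degree {v} v∈X = begin
      2 * suc k * D * n                                 ≡⟨ cong (2 * suc k * D *_) (length-split X! v∈X) ⟩
      2 * suc k * D * suc (r + b)                       ≡⟨ e (suc k) D r b ⟩
      2 * suc k * D * r + (2 * (suc k * D * b) + 2 * suc k * D)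
        ≤⟨ +-monoʳ-≤ (2 * suc k * D * r) (+-mono-≤ (*-monoʳ-≤ 2 few-blue) 2[1+k]D≤nA) ⟩
      2 * suc k * D * r + (2 * (n * k * A) + n * A)     ∎
      where
      r = length (nbhd true v X)
      b = length (nbhd false v X)
      few-blue : suc k * D * b ≤ n * k * A
      few-blue = subst (λ d → suc k * d * b ≤ n * k * A) (sym D≡6[k+j])
                   (blue-degree k j n b 0<k big (¬blue v∈X))
      e : ∀ s D r b → 2 * s * D * suc (r + b) ≡ 2 * s * D * r + (2 * (s * D * b) + 2 * s * D)
      e = solve-∀

    -- Blue degrees of at most a n k/(k+1) raise the red density above p by a/(k+1). Half of this
    -- pays for the vertex missing from its own degree; the other half is the excess.
    dense : 2 * suc k * (P * n * n) + A * n * n ≤ 2 * suc k * (D * E)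
    dense = +-cancelʳ-≤ (n * (2 * (n * k * A) + n * A)) _ _ (begin
      2 * suc k * (P * n * n) + A * n * n + n * (2 * (n * k * A) + n * A)
                                                        ≡⟨ e₁ k P A n ⟩
      n * (2 * suc k * D * n)                           ≡⟨ ∑-const X (2 * suc k * D * n) ⟨
      ∑ X (λ _ → 2 * suc k * D * n)                     ≤⟨ ∑-mono X degree ⟩
      ∑ X (λ v → 2 * suc k * D * length (nbhd true v X) + (2 * (n * k * A) + n * A))
                                                        ≡⟨ ∑-+ X (λ v → 2 * suc k * D * length (nbhd true v X)) (λ _ → 2 * (n * k * A) + n * A) ⟩
      ∑ X (λ v → 2 * suc k * D * length (nbhd true v X)) + ∑ X (λ _ → 2 * (n * k * A) + n * A)
                                                        ≡⟨ cong₂ _+_ (∑-*ˡ X (2 * suc k * D) (λ v → length (nbhd true v X))) (∑-const X (2 * (n * k * A) + n * A)) ⟩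
      2 * suc k * D * E + n * (2 * (n * k * A) + n * A) ≡⟨ cong (_+ n * (2 * (n * k * A) + n * A)) (*-assoc (2 * suc k) D E) ⟩
      2 * suc k * (D * E) + n * (2 * (n * k * A) + n * A) ∎)
      where
      e₁ : ∀ k P A n → 2 * suc k * (P * n * n) + A * n * n + n * (2 * (n * k * A) + n * A) ≡ n * (2 * suc k * (P + A) * n)
      e₁ = solve-∀

    0<n : 0 < n
    0<n = <-≤-trans (0<B k) B≤n

    excess⇒cliques : (∃ λ e → P * n * n + e ≡ D * E × A * n * n ≤ 2 * suc k * e) →
                     Clique true k (_∈ X) ⊎ Clique false (suc j) (_∈ X)
    excess⇒cliques (e , excess , e-large) = Sum.map (clique-mono Sum.reduce) Sum.reduce
      -- Both sets of the book are `X`, so its two blue outcomes merge.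
      (book k (suc j) X X e X! X! 0<e (≤-reflexive excess) (book-hypothesis e e-large))
      where
      0<e : 0 < e
      0<e = pos-*ʳ (2 * suc k) (<-≤-trans (*-pos (*-pos {A} {n} z<s 0<n) 0<n) e-large)

    cliques : Clique true k (_∈ X) ⊎ Clique false (suc j) (_∈ X)
    cliques = excess⇒cliques (subtract {2 * suc k} {P * n * n} {A * n * n} {D * E} (*-pos {2} {suc k} z<s z<s) dense)

  -- If some blue neighbourhood is big for j, the induction hypothesis there gains `v` for the blue
  -- clique. Otherwise all blue degrees are small and the dense case applies.
  ramsey : ∀ k → 0 < k → ∀ j → 4 * j ≤ k → ∀ X → Unique X → Big k j (length X) →
           Clique true k (_∈ X) ⊎ Clique false j (_∈ X)
  ramsey k 0<k zero    4j≤k X X! big = inj₂ clique-empty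
  ramsey k 0<k (suc j) 4j≤k X X! big with any? (λ v → Big? k j (length (nbhd false v X))) X
  ... | yes blue with v , v∈X , big-v ← find blue =
    Sum.map (clique-mono λ w∈nb → proj₁ (∈-filter⁻ (Adj? false v) w∈nb)) (clique-nbhd v∈X)
      (ramsey k 0<k j (≤-trans (*-monoʳ-≤ 4 (n≤1+n j)) 4j≤k) _ (nbhd-unique false v X!) big-v)
  -- With m = 5k, L = m + 1 is large enough for the loss per step to be harmless and still linear in
  -- k.
  ... | no ¬blue = DenseCase.cliques k j (6 * k ∸ suc j) (5 * k) 0<k 4j≤k
                     (m∸n+n≡m (≤-trans 1+j≤k (m≤m+n k (5 * k)))) 2[k+j]≤1+5k 1+5k≤8[1+k] (*-pos (z<s {4}) 0<k)
                     X X! big (λ v∈X → All.lookup (¬Any⇒All¬ X ¬blue) v∈X)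
    where
    open ≤-Reasoning
    1+j≤k : suc j ≤ k
    1+j≤k = ≤-trans (m≤m+n (suc j) (3 * suc j)) 4j≤k

    2[k+j]≤1+5k : 2 * (k + suc j) ≤ suc (5 * k)
    2[k+j]≤1+5k = begin
      2 * (k + suc j)   ≤⟨ *-monoʳ-≤ 2 (+-monoʳ-≤ k 1+j≤k) ⟩
      2 * (k + k)       ≡⟨ e k ⟩
      4 * k             ≤⟨ *-monoˡ-≤ k (m≤m+n 4 1) ⟩
      5 * k             ≤⟨ n≤1+n (5 * k) ⟩
      suc (5 * k)       ∎
      where
      e : ∀ k → 2 * (k + k) ≡ 4 * k
      e = solve-∀

    1+5k≤8[1+k] : suc (5 * k) ≤ 8 * suc k
    1+5k≤8[1+k] = +-mono-≤ {1} {suc k} (s≤s z≤n) (*-mono-≤ (m≤m+n 5 2) (n≤1+n k))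

-- From the integer bound to powers of two

open import Data.Integer using (+_; -[1+_])

big⇒Arrows : ∀ N k ℓ → 0 < k → 4 * ℓ ≤ k → Big k ℓ N → Arrows N k ℓ
big⇒Arrows N k ℓ 0<k 4ℓ≤k big c =
  Sum.map clique⇒MonoClique clique⇒MonoClique
    (ramsey c k 0<k ℓ 4ℓ≤k (List.allFin N) (Unique.allFin⁺ N) (subst (Big k ℓ) (sym (List.length-tabulate {n = N} (λ i → i))) big))
  where open Graph c

-- By minimality N = r - 1 vertices do not suffice, so N is not big. The missing 1 is absorbed by
-- `7^j≤6^jC`, and the factor (1 + 1/k)^ℓ by 2.
ramseyNumber-≤ : ∀ k ℓ r → 0 < k → 4 * ℓ ≤ k → IsRamseyNumber k ℓ r →
                 r * 7 ^ ℓ ≤ 2 * suc (B k) * (6 ^ ℓ * ((k + ℓ) C ℓ))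
ramseyNumber-≤ k ℓ zero    0<k 4ℓ≤k _           = z≤n
ramseyNumber-≤ k ℓ (suc N) 0<k 4ℓ≤k (_ , least) = cancelˡ (^-pos ℓ 0<k) (begin
  k ^ ℓ * (suc N * 7 ^ ℓ)                       ≡⟨ e₁ (k ^ ℓ) N (7 ^ ℓ) ⟩
  7 ^ ℓ * k ^ ℓ + N * (7 ^ ℓ * k ^ ℓ)           ≡⟨ cong (λ x → 7 ^ ℓ * k ^ ℓ + N * x) (*-^ 7 k ℓ) ⟨
  7 ^ ℓ * k ^ ℓ + N * (7 * k) ^ ℓ
    ≤⟨ +-mono-≤ (*-mono-≤ (7^j≤6^jC k ℓ 4ℓ≤k) (^-monoˡ-≤ ℓ (n≤1+n k))) (<⇒≤ (≰⇒> ¬big)) ⟩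
  6 ^ ℓ * T * suc k ^ ℓ + B k * ((6 * suc k) ^ ℓ * T)
    ≡⟨ cong (λ x → 6 ^ ℓ * T * suc k ^ ℓ + B k * (x * T)) (*-^ 6 (suc k) ℓ) ⟩
  6 ^ ℓ * T * suc k ^ ℓ + B k * (6 ^ ℓ * suc k ^ ℓ * T)
    ≡⟨ e₂ (6 ^ ℓ) T (suc k ^ ℓ) (B k) ⟩
  suc (B k) * (6 ^ ℓ * T) * suc k ^ ℓ
    ≤⟨ *-monoʳ-≤ (suc (B k) * (6 ^ ℓ * T)) (bernoulli-double k ℓ 2ℓ≤1+k) ⟩
  suc (B k) * (6 ^ ℓ * T) * (2 * k ^ ℓ)         ≡⟨ e₃ (suc (B k)) (6 ^ ℓ * T) 2 (k ^ ℓ) ⟩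
  k ^ ℓ * (2 * suc (B k) * (6 ^ ℓ * T))         ∎)
  where
  open ≤-Reasoning
  T = (k + ℓ) C ℓ
  ¬big : ¬ Big k ℓ N
  ¬big big = least N (n<1+n N) (big⇒Arrows N k ℓ 0<k 4ℓ≤k big)
  2ℓ≤1+k : 2 * ℓ ≤ suc k
  2ℓ≤1+k = ≤-trans (*-monoˡ-≤ ℓ (m≤m+n 2 2)) (≤-trans 4ℓ≤k (n≤1+n k))
  e₁ : ∀ x N y → x * (suc N * y) ≡ y * x + N * (y * x)
  e₁ = solve-∀
  e₂ : ∀ a t s b → a * t * s + b * (a * s * t) ≡ suc b * (a * t) * s
  e₂ = solve-∀
  e₃ : ∀ b a c x → b * a * (c * x) ≡ x * (c * b * a)
  e₃ = solve-∀

^-cancelˡ-≤ : ∀ n .{{_ : NonZero n}} {a b} → a ^ n ≤ b ^ n → a ≤ b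
^-cancelˡ-≤ n aⁿ≤bⁿ = ≮⇒≥ λ b<a → <⇒≱ (^-monoˡ-< n b<a) aⁿ≤bⁿ

^-comm : ∀ x m n → (x ^ m) ^ n ≡ (x ^ n) ^ m
^-comm x m n = trans (^-*-assoc x m n) (trans (cong (x ^_) (*-comm m n)) (sym (^-*-assoc x n m)))

-- With a/b = 6/7, 4 · 6⁹ ≤ 7⁹ turns (6/7)^ℓ into 2^(-2ℓ/9).
exchange-base : ∀ a b r ℓ G T → 0 < a → 4 * a ^ 9 ≤ b ^ 9 → r * b ^ ℓ ≤ 2 ^ G * (a ^ ℓ * T) →
                r ^ 9 * 2 ^ (2 * ℓ) ≤ 2 ^ (9 * G) * T ^ 9
exchange-base a b r ℓ G T 0<a 4a⁹≤b⁹ h = *-cancelʳ-≤ _ _ ((a ^ 9) ^ ℓ) {{>-nonZero (^-pos ℓ (^-pos 9 0<a))}} (begin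
  r ^ 9 * 2 ^ (2 * ℓ) * (a ^ 9) ^ ℓ             ≡⟨ cong (λ x → r ^ 9 * x * (a ^ 9) ^ ℓ) (^-*-assoc 2 2 ℓ) ⟨
  r ^ 9 * 4 ^ ℓ * (a ^ 9) ^ ℓ                   ≡⟨ *-assoc (r ^ 9) (4 ^ ℓ) ((a ^ 9) ^ ℓ) ⟩
  r ^ 9 * (4 ^ ℓ * (a ^ 9) ^ ℓ)                 ≡⟨ cong (r ^ 9 *_) (*-^ 4 (a ^ 9) ℓ) ⟨
  r ^ 9 * (4 * a ^ 9) ^ ℓ                       ≤⟨ *-monoʳ-≤ (r ^ 9) (^-monoˡ-≤ ℓ 4a⁹≤b⁹) ⟩
  r ^ 9 * (b ^ 9) ^ ℓ                           ≡⟨ cong (r ^ 9 *_) (^-comm b 9 ℓ) ⟩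
  r ^ 9 * (b ^ ℓ) ^ 9                           ≡⟨ *-^ r (b ^ ℓ) 9 ⟨
  (r * b ^ ℓ) ^ 9                               ≤⟨ ^-monoˡ-≤ 9 h ⟩
  (2 ^ G * (a ^ ℓ * T)) ^ 9                     ≡⟨ *-^ (2 ^ G) (a ^ ℓ * T) 9 ⟩
  (2 ^ G) ^ 9 * (a ^ ℓ * T) ^ 9                 ≡⟨ cong₂ _*_ (trans (^-*-assoc 2 G 9) (cong (2 ^_) (*-comm G 9))) (*-^ (a ^ ℓ) T 9) ⟩
  2 ^ (9 * G) * ((a ^ ℓ) ^ 9 * T ^ 9)           ≡⟨ cong (λ x → 2 ^ (9 * G) * (x * T ^ 9)) (^-comm a 9 ℓ) ⟨
  2 ^ (9 * G) * ((a ^ 9) ^ ℓ * T ^ 9)           ≡⟨ e (2 ^ (9 * G)) ((a ^ 9) ^ ℓ) (T ^ 9) ⟩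
  2 ^ (9 * G) * T ^ 9 * (a ^ 9) ^ ℓ             ∎)
  where
  open ≤-Reasoning
  e : ∀ x y z → x * (y * z) ≡ x * z * y
  e = solve-∀

-- Both inequalities say r ≤ 2^x T for x = (u - v)/d = (a - b)/q: the given one is raised to the
-- power q, then a d-th root is taken.
rescale-exponent : ∀ d .{{_ : NonZero d}} q a b u v r T → v * q + a * d ≡ u * q + b * d →
                   r ^ d * 2 ^ v ≤ 2 ^ u * T ^ d → r ^ q * 2 ^ b ≤ 2 ^ a * T ^ q
rescale-exponent d q a b u v r T eq h = ^-cancelˡ-≤ d (cancelˡ (^-pos (v * q) (z<s {1})) (begin
  2 ^ (v * q) * (r ^ q * 2 ^ b) ^ d             ≡⟨ cong (2 ^ (v * q) *_) (*-^ (r ^ q) (2 ^ b) d) ⟩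
  2 ^ (v * q) * ((r ^ q) ^ d * (2 ^ b) ^ d)     ≡⟨ cong₂ (λ x y → x * (y * (2 ^ b) ^ d)) (^-*-assoc 2 v q) (^-comm r d q) ⟨
  (2 ^ v) ^ q * ((r ^ d) ^ q * (2 ^ b) ^ d)     ≡⟨ e₁ ((2 ^ v) ^ q) ((r ^ d) ^ q) ((2 ^ b) ^ d) ⟩
  (r ^ d) ^ q * (2 ^ v) ^ q * (2 ^ b) ^ d       ≡⟨ cong₂ _*_ (*-^ (r ^ d) (2 ^ v) q) (sym (^-*-assoc 2 b d)) ⟨
  (r ^ d * 2 ^ v) ^ q * 2 ^ (b * d)             ≤⟨ *-monoˡ-≤ (2 ^ (b * d)) (^-monoˡ-≤ q h) ⟩
  (2 ^ u * T ^ d) ^ q * 2 ^ (b * d)             ≡⟨ cong (_* 2 ^ (b * d)) (*-^ (2 ^ u) (T ^ d) q) ⟩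
  (2 ^ u) ^ q * (T ^ d) ^ q * 2 ^ (b * d)       ≡⟨ cong₂ (λ x y → x * y * 2 ^ (b * d)) (^-*-assoc 2 u q) (^-comm T d q) ⟩
  2 ^ (u * q) * (T ^ q) ^ d * 2 ^ (b * d)       ≡⟨ e₂ (2 ^ (u * q)) ((T ^ q) ^ d) (2 ^ (b * d)) ⟩
  2 ^ (u * q) * 2 ^ (b * d) * (T ^ q) ^ d       ≡⟨ cong (_* (T ^ q) ^ d) (^-distribˡ-+-* 2 (u * q) (b * d)) ⟨
  2 ^ (u * q + b * d) * (T ^ q) ^ d             ≡⟨ cong (λ n → 2 ^ n * (T ^ q) ^ d) eq ⟨
  2 ^ (v * q + a * d) * (T ^ q) ^ d             ≡⟨ cong (_* (T ^ q) ^ d) (^-distribˡ-+-* 2 (v * q) (a * d)) ⟩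
  2 ^ (v * q) * 2 ^ (a * d) * (T ^ q) ^ d       ≡⟨ *-assoc (2 ^ (v * q)) (2 ^ (a * d)) _ ⟩
  2 ^ (v * q) * (2 ^ (a * d) * (T ^ q) ^ d)     ≡⟨ cong (λ y → 2 ^ (v * q) * (y * (T ^ q) ^ d)) (^-*-assoc 2 a d) ⟨
  2 ^ (v * q) * ((2 ^ a) ^ d * (T ^ q) ^ d)     ≡⟨ cong (2 ^ (v * q) *_) (*-^ (2 ^ a) (T ^ q) d) ⟨
  2 ^ (v * q) * (2 ^ a * T ^ q) ^ d             ∎))
  where
  open ≤-Reasoning
  e₁ : ∀ x y z → x * (y * z) ≡ y * x * z
  e₁ = solve-∀
  e₂ : ∀ x y z → x * y * z ≡ x * z * y
  e₂ = solve-∀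

cross-multiply : ∀ a b d u v q → (+ a ℤ.- + b) ℤ.* + d ≡ (+ u ℤ.- + v) ℤ.* + q →
                 v * q + a * d ≡ u * q + b * d
cross-multiply a b d u v q eq = ℤ.+-injective (begin
  + (v * q + a * d)                                         ≡⟨ pos-linear v q a d ⟩
  + v ℤ.* + q ℤ.+ + a ℤ.* + d                               ≡⟨ e₁ (+ v) (+ q) (+ a) (+ b) (+ d) ⟩
  (+ a ℤ.- + b) ℤ.* + d ℤ.+ (+ b ℤ.* + d ℤ.+ + v ℤ.* + q)   ≡⟨ cong (ℤ._+ (+ b ℤ.* + d ℤ.+ + v ℤ.* + q)) eq ⟩
  (+ u ℤ.- + v) ℤ.* + q ℤ.+ (+ b ℤ.* + d ℤ.+ + v ℤ.* + q)   ≡⟨ e₂ (+ u) (+ v) (+ q) (+ b) (+ d) ⟩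
  + u ℤ.* + q ℤ.+ + b ℤ.* + d                               ≡⟨ pos-linear u q b d ⟨
  + (u * q + b * d)                                         ∎)
  where
  open ≡-Reasoning
  pos-linear : ∀ a b c d → + (a * b + c * d) ≡ + a ℤ.* + b ℤ.+ + c ℤ.* + d
  pos-linear a b c d = trans (ℤ.pos-+ (a * b) (c * d)) (cong₂ ℤ._+_ (ℤ.pos-* a b) (ℤ.pos-* c d))
  e₁ : ∀ v q a b d → v ℤ.* q ℤ.+ a ℤ.* d ≡ (a ℤ.- b) ℤ.* d ℤ.+ (b ℤ.* d ℤ.+ v ℤ.* q)
  e₁ = ℤ-Solver.solve-∀
  e₂ : ∀ u v q b d → (u ℤ.- v) ℤ.* q ℤ.+ (b ℤ.* d ℤ.+ v ℤ.* q) ≡ u ℤ.* q ℤ.+ b ℤ.* d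
  e₂ = ℤ-Solver.solve-∀

-- `PowLe` reads x in lowest terms, so x is specified by cross-multiplication with (u - v)/d. The
-- sign of the numerator decides on which side the power of 2 stands.
PowLe-intro : ∀ d .{{_ : NonZero d}} r x T u v → ↥ x ℤ.* + d ≡ (+ u ℤ.- + v) ℤ.* + (↧ₙ x) →
              r ^ d * 2 ^ v ≤ 2 ^ u * T ^ d → PowLe r x T
PowLe-intro d r x T u v eq h with ↥ x
... | + p      = subst (_≤ 2 ^ p * T ^ q) (*-identityʳ (r ^ q))
                   (rescale-exponent d q p 0 u v r T
                     (cross-multiply p 0 d u v q (trans (cong (ℤ._* + d) (ℤ.+-identityʳ (+ p))) eq)) h)
  where q = ↧ₙ x
... | -[1+ p ] = subst (r ^ q * 2 ^ suc p ≤_) (*-identityˡ (T ^ q))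
                   (rescale-exponent d q 0 (suc p) u v r T (cross-multiply 0 (suc p) d u v q eq) h)
  where q = ↧ₙ x

-- Normalisation hides the numerator and denominator of x; the identity is read off from
-- unnormalised fractions.
exponent-fraction : ∀ G n → let x = (+ G / 1) - (+ n / 9) in
                    ↥ x ℤ.* + 9 ≡ (+ (9 * G) ℤ.- + n) ℤ.* + (↧ₙ x)
exponent-fraction G n = begin
  ↥ x ℤ.* + 9                                     ≡⟨ drop toℚᵘ-x ⟩
  (+ G ℤ.* + 9 ℤ.+ (ℤ.- + n) ℤ.* + 1) ℤ.* + (↧ₙ x)
    ≡⟨ cong (ℤ._* + (↧ₙ x)) (trans (e (+ G) (+ n)) (cong (ℤ._- + n) (sym (ℤ.pos-* 9 G)))) ⟩
  (+ (9 * G) ℤ.- + n) ℤ.* + (↧ₙ x)                ∎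
  where
  open ≡-Reasoning
  x = (+ G / 1) - (+ n / 9)
  toℚᵘ-x : toℚᵘ x ℚᵘ.≃ mkℚᵘ (+ G) 0 ℚᵘ.- mkℚᵘ (+ n) 8
  toℚᵘ-x = ℚᵘ.≃-trans (ℚ.toℚᵘ-homo-+ (+ G / 1) (ℚ.- (+ n / 9)))
    (ℚᵘ.+-cong (ℚ.toℚᵘ-fromℚᵘ (mkℚᵘ (+ G) 0))
      (ℚᵘ.≃-trans (ℚ.toℚᵘ-homo‿- (+ n / 9)) (ℚᵘ.-‿cong (ℚ.toℚᵘ-fromℚᵘ (mkℚᵘ (+ n) 8)))))
  drop : ∀ {x y} → toℚᵘ x ℚᵘ.≃ y → ↥ x ℤ.* ℚᵘ.↧ y ≡ ℚᵘ.↥ y ℤ.* + (↧ₙ x)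
  drop {mkℚ _ _ _} (*≡* eq) = eq
  e : ∀ G n → G ℤ.* + 9 ℤ.+ (ℤ.- n) ℤ.* + 1 ≡ + 9 ℤ.* G ℤ.- n
  e = ℤ-Solver.solve-∀

-- Binary logarithms and the sublinear exponent.

-- The lower bound on 2^s lets powers of 2 dominate the polynomial factor; the upper bound keeps s
-- logarithmic. When s has to grow, 2^s is exactly k + 1.
∃-log : ∀ k → ∃ λ s → suc k ≤ 2 ^ s × 2 ^ s ≤ 2 * suc k
∃-log zero    = 0 , ≤-refl , s≤s z≤n
∃-log (suc k) with ∃-log k
... | s , 1+k≤2^s , 2^s≤2[1+k] with 2 + k ≤? 2 ^ s
...   | yes 2+k≤2^s = s , 2+k≤2^s , ≤-trans 2^s≤2[1+k] (*-monoʳ-≤ 2 (n≤1+n (suc k)))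
...   | no  2+k≰2^s = suc s , ≤-trans (s≤s (s≤s (m≤m+n k (k + 0)))) (≤-trans (≤-reflexive (e k)) (*-monoʳ-≤ 2 1+k≤2^s))
                            , *-monoʳ-≤ 2 (≤-trans (s≤s⁻¹ (≰⇒> 2+k≰2^s)) (n≤1+n (suc k)))
  where
  e : ∀ k → 2 + (k + (k + 0)) ≡ 2 * suc k
  e = solve-∀

-- If c ≤ 2^(n+1), the increment c is covered by the doubling of 2 · 2^n; otherwise n + 1 < c and c²
-- suffices.
linear≤exponential : ∀ c n → c * n ≤ 2 * 2 ^ n + c * c
linear≤exponential c zero    = ≤-trans (≤-reflexive (*-zeroʳ c)) z≤n
linear≤exponential c (suc n) with c ≤? 2 * 2 ^ n
... | yes c≤2^1+n = begin
  c * suc n                                     ≡⟨ *-suc c n ⟩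
  c + c * n                                     ≤⟨ +-mono-≤ c≤2^1+n (linear≤exponential c n) ⟩
  2 * 2 ^ n + (2 * 2 ^ n + c * c)               ≡⟨ e (2 ^ n) c ⟩
  2 * 2 ^ suc n + c * c                         ∎
  where
  open ≤-Reasoning
  e : ∀ x c → 2 * x + (2 * x + c * c) ≡ 2 * (2 * x) + c * c
  e = solve-∀
... | no  c≰2^1+n = ≤-trans (*-monoʳ-≤ c (<⇒≤ (<-trans (n<2^n (suc n)) (≰⇒> c≰2^1+n)))) (m≤n+m (c * c) _)
  where
  n<2^n : ∀ n → n < 2 ^ n
  n<2^n zero    = z<s
  n<2^n (suc n) = +-mono-≤ (m^n>0 2 n) (≤-trans (n<2^n n) (≤-reflexive (sym (+-identityʳ (2 ^ n)))))

log₂↑ : ℕ → ℕ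
log₂↑ k = proj₁ (∃-log k)

-- The exponent of 128(k+1)³, an upper bound for 2(1 + `B k`), with k + 1 rounded up to a power of
-- 2.
loss : ℕ → ℕ
loss k = 3 * log₂↑ k + 7

2[1+B]≤2^loss : ∀ k → 2 * suc (B k) ≤ 2 ^ loss k
2[1+B]≤2^loss k = begin
  2 * suc (B k)                         ≤⟨ *-monoʳ-≤ 2 (+-monoˡ-≤ (B k) (≤-trans (s≤s z≤n) (m≤n*m (cube (suc k)) 32))) ⟩
  2 * (32 * cube (suc k) + 32 * cube (suc k)) ≡⟨ e (cube (suc k)) ⟩
  cube (suc k) * 128                    ≤⟨ *-monoˡ-≤ 128 (cube-mono (proj₁ (proj₂ (∃-log k)))) ⟩
  cube (2 ^ s) * 128                    ≡⟨ cong (_* 128) (cube-^ 2 s) ⟩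
  (2 ^ 3) ^ s * 2 ^ 7                   ≡⟨ cong (_* 2 ^ 7) (^-*-assoc 2 3 s) ⟩
  2 ^ (3 * s) * 2 ^ 7                   ≡⟨ ^-distribˡ-+-* 2 (3 * s) 7 ⟨
  2 ^ loss k                            ∎
  where
  open ≤-Reasoning
  s = log₂↑ k
  e : ∀ x → 2 * (32 * x + 32 * x) ≡ x * 128
  e = solve-∀

loss-sublinear : ∀ b k → let c = 24 * b in 4 + c * c + 56 * b ≤ k → loss k * b ≤ k
loss-sublinear b k large = *-cancelˡ-≤ 8 (begin
  8 * (loss k * b)                      ≡⟨ e₁ s b ⟩
  -- After scaling by 8, the exponential term takes at most 4k + 4, leaving 4k for the constants.
  c * s + 56 * b                        ≤⟨ +-monoˡ-≤ (56 * b) (linear≤exponential c s) ⟩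
  2 * 2 ^ s + c * c + 56 * b            ≤⟨ +-monoˡ-≤ (56 * b) (+-monoˡ-≤ (c * c) (*-monoʳ-≤ 2 (proj₂ (proj₂ (∃-log k))))) ⟩
  2 * (2 * suc k) + c * c + 56 * b      ≡⟨ e₂ k (c * c) (56 * b) ⟩
  4 * k + (4 + c * c + 56 * b)          ≤⟨ +-monoʳ-≤ (4 * k) (≤-trans large (m≤m+n k (3 * k))) ⟩
  4 * k + 4 * k                         ≡⟨ *-distribʳ-+ k 4 4 ⟨
  8 * k                                 ∎)
  where
  open ≤-Reasoning
  c = 24 * b
  s = log₂↑ k
  e₁ : ∀ s b → 8 * ((3 * s + 7) * b) ≡ 24 * b * s + 56 * b
  e₁ = solve-∀
  e₂ : ∀ k x y → 2 * (2 * suc k) + x + y ≡ 4 * k + (4 + x + y)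
  e₂ = solve-∀

g : ℕ → ℚ
g k = + loss k / 1

g-sublinear : SublinearFn g
-- Positivity makes the numerator at least 1, so ε ≥ 1/b, and the threshold is the one for 1/b.
g-sublinear ε@(mkℚ (+ suc a) b-1 _) _ = 4 + 24 * b * (24 * b) + 56 * b , λ k large →
  subst (ℚ._≤ ε ℚ.* (+ k / 1)) (sym (∣g∣≡g k)) (ℚ.toℚᵘ-cancel-≤ (begin
    toℚᵘ (g k)                                  ≃⟨ ℚ.toℚᵘ-fromℚᵘ (mkℚᵘ (+ loss k) 0) ⟩
    mkℚᵘ (+ loss k) 0                           ≤⟨ *≤* (bound k large) ⟩
    toℚᵘ ε ℚᵘ.* mkℚᵘ (+ k) 0                    ≃⟨ ℚᵘ.*-congˡ {toℚᵘ ε} (ℚ.toℚᵘ-fromℚᵘ (mkℚᵘ (+ k) 0)) ⟨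
    toℚᵘ ε ℚᵘ.* toℚᵘ (+ k / 1)                ≃⟨ ℚ.toℚᵘ-homo-* ε (+ k / 1) ⟨
    toℚᵘ (ε ℚ.* (+ k / 1))                    ∎))
  where
  open ℚᵘ.≤-Reasoning
  b = suc b-1
  ∣g∣≡g : ∀ k → ℚ.∣ g k ∣ ≡ g k
  ∣g∣≡g k = ℚ.0≤p⇒∣p∣≡p (ℚ.nonNegative⁻¹ (g k) {{ℚ.normalize-nonNeg (loss k) 1}})
  bound : ∀ k → 4 + 24 * b * (24 * b) + 56 * b ≤ k →
          + loss k ℤ.* + (b * 1) ℤ.≤ (+ suc a ℤ.* + k) ℤ.* + 1
  bound k large = subst₂ ℤ._≤_ (ℤ.pos-* (loss k) (b * 1))
                    (sym (trans (ℤ.*-identityʳ (+ suc a ℤ.* + k)) (sym (ℤ.pos-* (suc a) k))))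
                    (ℤ.+≤+ (≤-trans (≤-reflexive (cong (loss k *_) (*-identityʳ b)))
                             (≤-trans (loss-sublinear b k large) (m≤m+n k (a * k)))))

theorem4p4 : Σ (ℕ → ℚ) λ g → SublinearFn g ×
    (∀ k ℓ → 2 ≤ k → 2 ≤ ℓ → 4 * ℓ ≤ k → ∀ r → IsRamseyNumber k ℓ r →
    PowLe r (g k - (+ (2 * ℓ)) / 9) ((k + ℓ) C ℓ))
theorem4p4 = g , g-sublinear , λ k ℓ 2≤k _ 4ℓ≤k r r-ramsey →
  PowLe-intro 9 r (g k - (+ (2 * ℓ)) / 9) ((k + ℓ) C ℓ) (9 * loss k) (2 * ℓ)
    (exponent-fraction (loss k) (2 * ℓ))
    (exchange-base 6 7 r ℓ (loss k) ((k + ℓ) C ℓ) z<s (≤ᵇ⇒≤ (4 * 6 ^ 9) (7 ^ 9) _)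
      (≤-trans (ramseyNumber-≤ k ℓ r (≤-trans (s≤s z≤n) 2≤k) 4ℓ≤k r-ramsey)
        (*-monoˡ-≤ (6 ^ ℓ * ((k + ℓ) C ℓ)) (2[1+B]≤2^loss k))))
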